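{- Let $B$ be a finite connected left regular band (possibly without identity), $\Bbbk$ a commutative ring with unit, and $X\in\Lambda(B)$. Then the augmented simplicial chain complex $C_\bullet(\Delta(B_{\ge X});\Bbbk)\xrightarrow{\ \varepsilon\ }\Bbbk_X$ is a projective resolution of $\Bbbk_X$ by $\Bbbk B$-modules.
   Context: A left regular band is a finite semigroup $B$ with $x^2=x$ and $xyx=xy$ for all $x,y$. The $\mathcal R$-order is $a\le b$ iff $ba=a$. $\Lambda(B)=\{Ba:a\in B\}$ (where $Ba=\{ba:b\in B\}$) ordered by inclusion, $\sigma(a)=Ba$. For $X\in\Lambda(B)$, $B_{\ge X}=\{z\in B:\sigma(z)\ge X\}$ with the $\mathcal R$-order, and $\Delta(B_{\ge X})$ is its order complex. $B$ is connected if every $\Delta(B_{\ge X})$ is connected. $\Bbbk_X$ is $\Bbbk$ with $b$ acting as $1$ if $\sigma(b)\ge X$ and $0$ otherwise. The chain groups are $\Bbbk B$-modules via left multiplication: $b$ sends a chain $z_0<\cdots<z_q$ in $B_{\ge X}$ to $bz_0<\cdots<bz_q$ when $\sigma(b)\ge X$ and this is again a chain of $q+1$ distinct elements, and to $0$ otherwise; $\varepsilon$ sends each vertex to $1$. -}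

module Defs where

open import Level using (Level; _⊔_)
open import Data.Nat using (ℕ; zero; suc)
open import Data.Fin using (Fin; toℕ)
open import Data.Fin.Properties using (all?; any?) renaming (_≟_ to _≟F_)
open import Data.Vec using (Vec; []; _∷_; removeAt; map)
open import Data.Vec.Properties using (≡-dec)
open import Data.Vec.Relation.Unary.All using (All) renaming (all? to allV?)
open import Data.Vec.Relation.Unary.Linked using (Linked; linked?)
open import Data.List as List using (List; []; _∷_; _++_; concatMap; allFin)
open import Data.Product using (Σ; ∃; ∃-syntax; _×_; _,_)
open import Relation.Nullary using (Dec; yes; no; ¬_; _×-dec_; ¬?)
open import Relation.Binary.PropositionalEquality using (_≡_)
open import Relation.Binary.Construct.Closure.ReflexiveTransitive using (Star)
open import Algebra.Bundles using (CommutativeRing)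
open import Algebra.Module.Bundles using (Module)

record LRB : Set where
  infixl 7 _·_
  field
    n       : ℕ
    _·_     : Fin n → Fin n → Fin n
    assoc   : ∀ x y z → (x · y) · z ≡ x · (y · z)
    idem    : ∀ x → x · x ≡ x
    leftReg : ∀ x y → x · y · x ≡ x · y

module LRBNotions (B : LRB) where
  open LRB B public

  _≤R_ : Fin n → Fin n → Set
  a ≤R b = b · a ≡ a

  _<R_ : Fin n → Fin n → Set
  a <R b = (a ≤R b) × ¬ (a ≡ b)

  _<R?_ : ∀ a b → Dec (a <R b)
  a <R? b = ((b · a) ≟F a) ×-dec ¬? (a ≟F b)

  -- σ(a) = B a ∈ Λ(B).  An element X ∈ Λ(B) is given as σ(x) for some x.
  -- σ(z) ≥ σ(x)  iff  B x ⊆ B z :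
  _∈B≥_ : Fin n → Fin n → Set
  z ∈B≥ x = ∀ b → ∃[ c ] (c · z ≡ b · x)

  _∈B≥?_ : ∀ z x → Dec (z ∈B≥ x)
  z ∈B≥? x = all? (λ b → any? (λ c → (c · z) ≟F (b · x)))

  -- Connectedness of the order complex Δ(B_{≥σ(x)}): its 1-skeleton is the
  -- comparability graph of the poset B_{≥σ(x)}; Δ is connected iff it is
  -- nonempty (it always contains x) and any two vertices are joined by a path.
  Edge : Fin n → Fin n → Fin n → Set
  Edge x u v = (u ∈B≥ x) × (v ∈B≥ x) × ((u ≤R v) Data.Sum.⊎ (v ≤R u))
    where import Data.Sum

  ConnectedΔ : Fin n → Set
  ConnectedΔ x = ∀ u v → u ∈B≥ x → v ∈B≥ x → Star (Edge x) u v

  Connected : Set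
  Connected = ∀ x → ConnectedΔ x

  IsChain : ∀ {k} → Fin n → Vec (Fin n) k → Set
  IsChain x v = All (_∈B≥ x) v × Linked _<R_ v

  isChain? : ∀ {k} x (v : Vec (Fin n) k) → Dec (IsChain x v)
  isChain? x v = allV? (λ z → z ∈B≥? x) v ×-dec linked? _<R?_ v

module _ {c ℓ : Level} (R : CommutativeRing c ℓ) (B : LRB) where
  open CommutativeRing R renaming (Carrier to K)
  open LRB B using (n) renaming (_·_ to _·B_)

  record RawKBModule (a ℓa : Level) : Set (c ⊔ Level.suc (a ⊔ ℓa)) where
    field
      Carrier : Set a
      _≈_     : Carrier → Carrier → Set ℓa
      _⊕_     : Carrier → Carrier → Carrier
      _•_     : K → Carrier → Carrier
      _▹_     : Fin n → Carrier → Carrier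

  record IsKBHom {a ℓa a' ℓa'} (M : RawKBModule a ℓa) (N : RawKBModule a' ℓa')
                 (f : RawKBModule.Carrier M → RawKBModule.Carrier N)
                 : Set (c ⊔ a ⊔ ℓa ⊔ ℓa') where
    private
      module M = RawKBModule M
      module N = RawKBModule N
    field
      cong  : ∀ {x y} → x M.≈ y → f x N.≈ f y
      hom-⊕ : ∀ x y → f (x M.⊕ y) N.≈ (f x N.⊕ f y)
      hom-• : ∀ r x → f (r M.• x) N.≈ (r N.• f x)
      hom-▹ : ∀ b x → f (b M.▹ x) N.≈ (b N.▹ f x)

  -- A (genuine) 𝕜B-module: a 𝕜-module with an associative, 𝕜-linear B-action.
  -- (B need not have an identity; these are exactly the modules over 𝕜B.)
  record KBModule (m ℓm : Level) : Set (c ⊔ ℓ ⊔ Level.suc (m ⊔ ℓm)) where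
    field
      module𝕜 : Module R m ℓm
    open Module module𝕜
    field
      _▹_     : Fin n → Carrierᴹ → Carrierᴹ
      ▹-cong  : ∀ b {x y} → x ≈ᴹ y → (b ▹ x) ≈ᴹ (b ▹ y)
      ▹-+     : ∀ b x y → (b ▹ (x +ᴹ y)) ≈ᴹ ((b ▹ x) +ᴹ (b ▹ y))
      ▹-*ₗ    : ∀ b r x → (b ▹ (r *ₗ x)) ≈ᴹ (r *ₗ (b ▹ x))
      ▹-assoc : ∀ b b' x → ((b ·B b') ▹ x) ≈ᴹ (b ▹ (b' ▹ x))

    raw : RawKBModule m ℓm
    raw = record { Carrier = Carrierᴹ ; _≈_ = _≈ᴹ_ ; _⊕_ = _+ᴹ_
                 ; _•_ = _*ₗ_ ; _▹_ = _▹_ }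

  Projective : ∀ {a ℓa} (m ℓm : Level) → RawKBModule a ℓa
             → Set (c ⊔ ℓ ⊔ a ⊔ ℓa ⊔ Level.suc (m ⊔ ℓm))
  Projective m ℓm P =
    (M N : KBModule m ℓm) →
    let module M = KBModule M ; module N = KBModule N
        module M𝕜 = Module M.module𝕜 ; module N𝕜 = Module N.module𝕜 in
    (π : N𝕜.Carrierᴹ → M𝕜.Carrierᴹ) → IsKBHom N.raw M.raw π →
    (∀ y → ∃[ x ] (π x M𝕜.≈ᴹ y)) →
    (f : RawKBModule.Carrier P → M𝕜.Carrierᴹ) → IsKBHom P M.raw f →
    ∃[ g ] (IsKBHom P N.raw g × (∀ p → π (g p) M𝕜.≈ᴹ f p))

module ChainComplex {c ℓ : Level} (R : CommutativeRing c ℓ) (B : LRB) (x : Fin (LRB.n B)) where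
  open CommutativeRing R renaming (Carrier to K)
  open LRBNotions B

  -- An element of C_q is a finite formal 𝕜-combination of (q+1)-tuples;
  -- only tuples that are chains in B_{≥X} count (others are zero).
  Chains : ℕ → Set c
  Chains q = List (K × Vec (Fin n) (suc q))

  Σ𝕜 : List K → K
  Σ𝕜 = List.foldr _+_ 0#

  coeff : ∀ {q} → Chains q → Vec (Fin n) (suc q) → K
  coeff {q} f s with isChain? x s
  ... | no _  = 0#
  ... | yes _ = Σ𝕜 (List.map (λ { (r , v) → pick r v }) f)
    where
      pick : K → Vec (Fin n) (suc q) → K
      pick r v with ≡-dec _≟F_ v s
      ... | yes _ = r
      ... | no  _ = 0#

  _≈C_ : ∀ {q} → Chains q → Chains q → Set ℓ
  f ≈C g = ∀ s → coeff f s ≈ coeff g s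

  sgn : ℕ → K → K
  sgn zero    r = r
  sgn (suc i) r = - sgn i r

  -- B-action on chains: b·(z₀<⋯<z_q) = bz₀<⋯<bz_q if σ(b) ≥ X (zero if it
  -- is not again a chain of q+1 distinct elements, which ≈C handles), else 0
  actC : ∀ {q} → Fin n → Chains q → Chains q
  actC b f = concatMap act1 f
    where
      act1 : _ → Chains _
      act1 (r , v) with b ∈B≥? x | isChain? x v
      ... | yes _ | yes _ = (r , map (b ·_) v) ∷ []
      ... | _     | _     = []

  C : ℕ → RawKBModule R B c ℓ
  C q = record
    { Carrier = Chains q
    ; _≈_     = _≈C_
    ; _⊕_     = _++_
    ; _•_     = λ r f → List.map (λ { (s , v) → (r * s , v) }) f
    ; _▹_     = actC
    }

  ∂ : ∀ {q} → Chains (suc q) → Chains q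
  ∂ {q} f = concatMap faces f
    where
      faces : K × Vec (Fin n) (suc (suc q)) → Chains q
      faces (r , v) with isChain? x v
      ... | no _  = []
      ... | yes _ = List.map (λ i → (sgn (toℕ i) r , removeAt v i)) (allFin (suc (suc q)))

  𝕜X : RawKBModule R B c ℓ
  𝕜X = record
    { Carrier = K ; _≈_ = _≈_ ; _⊕_ = _+_ ; _•_ = _*_
    ; _▹_ = λ b r → act b r }
    where
      act : Fin n → K → K
      act b r with b ∈B≥? x
      ... | yes _ = r
      ... | no  _ = 0#

  ε : Chains 0 → K
  ε f = Σ𝕜 (List.map val f)
    where
      val : K × Vec (Fin n) 1 → K
      val (r , v) with isChain? x v
      ... | yes _ = r
      ... | no  _ = 0#

  record IsProjectiveResolution (m ℓm : Level) : Set (c ⊔ ℓ ⊔ Level.suc (m ⊔ ℓm)) where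
    field
      ε-hom     : IsKBHom R B (C 0) 𝕜X ε
      ∂-hom     : ∀ q → IsKBHom R B (C (suc q)) (C q) ∂
      ε∂≈0      : ∀ (f : Chains 1) → ε (∂ f) ≈ 0#
      ∂∂≈0      : ∀ q (f : Chains (suc (suc q))) → ∂ (∂ f) ≈C []
      ε-surj    : ∀ r → ∃[ f ] (ε f ≈ r)
      exact₀    : ∀ (f : Chains 0) → ε f ≈ 0# → ∃[ g ] (∂ g ≈C f)
      exact     : ∀ q (f : Chains (suc q)) → ∂ f ≈C [] → ∃[ g ] (∂ g ≈C f)
      projective : ∀ q → Projective R B m ℓm (C q)

{-# OPTIONS --safe #-}
module Submission where

-- For a list l of elements of B let Π_l be the product of the factors 1 - s,
-- s ∈ l, and let P be this product over all of B.  Since bub = bu, an element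
-- b ∈ l satisfies b u Π_l = 0 for every u; in particular B P = 0.  If every
-- B_{≥X} has a connected order complex, then also P B = 0 on every module:
-- descending induction on X shows P v w = 0 whenever w is killed by the
-- elements not above X, because P v w is then constant along comparabilities
-- of B_{≥X}, while P = P P forces the constant to vanish.
--
-- A chain z₀ < ⋯ < z_q is fixed by z_q, so P = 0 on C_q.  On the other hand b
-- acts on the augmented complex null-homotopically, its image being a cone
-- with apex b; so a cycle f is homologous to P f = 0, which gives exactness.
--
-- For projectivity a lift g is built by induction on the σ-class of the top y
-- of a chain v: with r the canonical chain in the orbit of v, Q the product of
-- the 1 - s over s not above y, and m a lift of f r, the element y Q r of C_q
-- equals v plus chains with smaller top, and g v is y Q m minus the value of g
-- on these smaller chains.

open import Defs
open import Level using (Level; _⊔_) renaming (suc to lsuc)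
open import Data.Bool.Base using (true)
open import Data.Nat as ℕ using (ℕ; zero; suc; _≤_; _<_; s≤s)
import Data.Nat.Properties as ℕ
open import Data.Fin using (Fin; zero; suc; toℕ; punchIn)
open import Data.Fin.Properties using (punchInᵢ≢i) renaming (_≟_ to _≟F_)
open import Data.Fin.Induction using (spo-wellFounded; spo-noetherian)
import Data.Fin.Subset as Subset
import Data.Fin.Subset.Properties as Subset
open import Data.List.Base as List using (List; []; _∷_; _++_; allFin; concatMap; filter)
import Data.List.Properties as List
open import Data.List.Membership.Propositional using (_∈_)
open import Data.List.Membership.Propositional.Properties using (∈-filter⁺; ∈-filter⁻; ∈-allFin)
open import Data.List.Relation.Unary.Any using (here; there)
open import Data.List.Relation.Unary.All as ListAll using ([]; _∷_)
import Data.List.Relation.Unary.All.Properties as ListAll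
open import Data.Vec.Base as Vec using (Vec; []; _∷_; removeAt; _∷ʳ_)
open import Data.Vec.Properties as Vec using (≡-dec)
open import Data.Vec.Relation.Unary.All as All using (All; []; _∷_)
import Data.Vec.Relation.Unary.All.Properties as All
open import Data.Vec.Relation.Unary.Linked as Linked using (Linked; []; [-]; _∷_)
import Data.Vec.Relation.Unary.Linked.Properties as Linked
open import Data.Product using (∃-syntax; _×_; _,_; proj₁; proj₂)
open import Data.Sum using (_⊎_; inj₁; inj₂; map₁)
open import Function.Base using (_∘_; flip)
open import Relation.Nullary using (Dec; yes; no; ¬_; ¬?; _×-dec_; does; contradiction)
open import Relation.Nullary.Decidable using (dec-true)
open import Relation.Binary.PropositionalEquality
  using (_≡_; refl; sym; trans; cong; cong₂; subst; subst₂; isEquivalence; module ≡-Reasoning)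
open import Relation.Binary.Structures using (IsStrictPartialOrder)
open import Relation.Binary.Construct.Closure.ReflexiveTransitive using (Star; _◅_) renaming (ε to ∎ₛ)
open import Induction.WellFounded using (WellFounded; Acc; acc)
open import Algebra.Bundles using (AbelianGroup; CommutativeMonoid; CommutativeRing)
open import Algebra.Module.Bundles using (Module)
open import Algebra.Module.Construct.TensorUnit using (⟨module⟩)
import Algebra.Properties.AbelianGroup as AbelianGroupProperties
import Algebra.Properties.CommutativeMonoid.Sum as MonoidSum
import Relation.Binary.Reasoning.Setoid as SetoidReasoning

-- The support preorder on `B`, whose classes are the elements of Λ(B).

module LRBOrder (B : LRB) where
  open LRBNotions B

  infix 4 _≤σ_ _<σ_ _≤σ?_

  -- In a left regular band this equation amounts to Ba ⊆ Bb. Replacing the inclusion in `_∈B≥_` by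
  -- it turns order arguments into rewriting in `B`.
  _≤σ_ : Fin n → Fin n → Set
  a ≤σ b = a · b ≡ a

  _≤σ?_ : ∀ a b → Dec (a ≤σ b)
  a ≤σ? b = a · b ≟F a

  _<σ_ : Fin n → Fin n → Set
  a <σ b = a ≤σ b × ¬ b ≤σ a

  ∈B≥⇒≤σ : ∀ {z x} → z ∈B≥ x → x ≤σ z
  ∈B≥⇒≤σ {z} {x} z≥x with z≥x x
  ... | c , cz≡xx = begin
    x · z       ≡⟨ cong (_· z) x≡cz ⟩
    c · z · z   ≡⟨ assoc c z z ⟩
    c · (z · z) ≡⟨ cong (c ·_) (idem z) ⟩
    c · z       ≡⟨ sym x≡cz ⟩
    x           ∎
    where
    open ≡-Reasoning
    x≡cz : x ≡ c · z
    x≡cz = sym (trans cz≡xx (idem x))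

  ≤σ⇒∈B≥ : ∀ {z x} → x ≤σ z → z ∈B≥ x
  ≤σ⇒∈B≥ {z} {x} x≤z b = b · x , trans (assoc b x z) (cong (b ·_) x≤z)

  ≤σ-refl : ∀ {a} → a ≤σ a
  ≤σ-refl = idem _

  ≤σ-trans : ∀ {a b c} → a ≤σ b → b ≤σ c → a ≤σ c
  ≤σ-trans {a} {b} {c} a≤b b≤c = begin
    a · c       ≡⟨ cong (_· c) (sym a≤b) ⟩
    a · b · c   ≡⟨ assoc a b c ⟩
    a · (b · c) ≡⟨ cong (a ·_) b≤c ⟩
    a · b       ≡⟨ a≤b ⟩
    a           ∎
    where open ≡-Reasoning

  ≤σ-·ˡ : ∀ {a b} → a · b ≤σ a
  ≤σ-·ˡ {a} {b} = leftReg a b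

  ≤σ-·ʳ : ∀ {a b} → a · b ≤σ b
  ≤σ-·ʳ {a} {b} = trans (assoc a b b) (cong (a ·_) (idem b))

  -- Together with `≤σ-·ˡ` and `≤σ-·ʳ` this makes σ(b · c) the meet of σ(b) and σ(c).
  ≤σ-glb : ∀ {a b c} → a ≤σ b → a ≤σ c → a ≤σ b · c
  ≤σ-glb {a} {b} {c} a≤b a≤c = begin
    a · (b · c) ≡⟨ assoc a b c ⟨
    a · b · c   ≡⟨ cong (_· c) a≤b ⟩
    a · c       ≡⟨ a≤c ⟩
    a           ∎
    where open ≡-Reasoning

  <σ-trans : ∀ {a b c} → a <σ b → b <σ c → a <σ c
  <σ-trans (a≤b , _) (b≤c , c≰b) = ≤σ-trans a≤b b≤c , λ c≤a → c≰b (≤σ-trans c≤a a≤b)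

  <σ-≤σ-trans : ∀ {a b c} → a ≤σ b → b <σ c → a <σ c
  <σ-≤σ-trans a≤b (b≤c , c≰b) = ≤σ-trans a≤b b≤c , λ c≤a → c≰b (≤σ-trans c≤a a≤b)

  <σ-isStrictPartialOrder : IsStrictPartialOrder _≡_ _<σ_
  <σ-isStrictPartialOrder = record
    { isEquivalence = isEquivalence
    ; irrefl        = λ { refl (a≤b , b≰a) → b≰a a≤b }
    ; trans         = <σ-trans
    ; <-resp-≈      = (λ { refl p → p }) , λ { refl p → p }
    }

  <σ-wellFounded : WellFounded _<σ_
  <σ-wellFounded = spo-wellFounded <σ-isStrictPartialOrder

  <σ-noetherian : WellFounded (flip _<σ_)
  <σ-noetherian = spo-noetherian <σ-isStrictPartialOrder

-- Abelian groups with an action of `B`, and additive maps between them.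

record BAction (B : LRB) (a ℓ : Level) : Set (lsuc (a ⊔ ℓ)) where
  open LRB B
  infixr 8 _▹_
  field
    group : AbelianGroup a ℓ
  open AbelianGroup group public
    renaming (_∙_ to _+_; ε to 0#; _⁻¹ to -_; ∙-cong to +-cong; ∙-congˡ to +-congˡ;
              ∙-congʳ to +-congʳ; identityˡ to +-identityˡ; identityʳ to +-identityʳ;
              inverseʳ to -‿inverseʳ; inverseˡ to -‿inverseˡ; ⁻¹-cong to -‿cong;
              assoc to +-assoc; comm to +-comm; refl to ≈-refl; sym to ≈-sym; trans to ≈-trans;
              reflexive to ≈-reflexive)
    using (Carrier; _≈_; _-_; setoid)
  field
    _▹_     : Fin n → Carrier → Carrier
    ▹-cong  : ∀ b {x y} → x ≈ y → b ▹ x ≈ b ▹ y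
    ▹-+     : ∀ b x y → b ▹ (x + y) ≈ b ▹ x + b ▹ y
    ▹-assoc : ∀ b b′ x → (b · b′) ▹ x ≈ b ▹ (b′ ▹ x)

record Additive {a ℓ a′ ℓ′} (G : AbelianGroup a ℓ) (H : AbelianGroup a′ ℓ′)
                (h : AbelianGroup.Carrier G → AbelianGroup.Carrier H) : Set (a ⊔ ℓ ⊔ ℓ′) where
  private
    module G = AbelianGroup G
    module H = AbelianGroup H
  open AbelianGroupProperties H
  field
    ⟦⟧-cong : ∀ {x y} → x G.≈ y → h x H.≈ h y
    ∙-homo  : ∀ x y → h (x G.∙ y) H.≈ h x H.∙ h y

  ε-homo : h G.ε H.≈ H.ε
  ε-homo = identityʳ-unique (h G.ε) (h G.ε) (H.trans (H.sym (∙-homo G.ε G.ε)) (⟦⟧-cong (G.identityˡ G.ε)))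

  ⁻¹-homo : ∀ x → h (x G.⁻¹) H.≈ h x H.⁻¹
  ⁻¹-homo x = inverseʳ-unique (h x) (h (x G.⁻¹))
    (H.trans (H.sym (∙-homo x (x G.⁻¹))) (H.trans (⟦⟧-cong (G.inverseʳ x)) ε-homo))

  minus-homo : ∀ x y → h (x G.- y) H.≈ h x H.- h y
  minus-homo x y = H.trans (∙-homo x (y G.⁻¹)) (H.∙-congˡ (⁻¹-homo y))

module Subtraction {a ℓ} (G : AbelianGroup a ℓ) where
  open AbelianGroup G renaming (refl to ≈-refl; sym to ≈-sym; trans to ≈-trans)
  open AbelianGroupProperties G
  open SetoidReasoning setoid

  -‿cong₂ : ∀ {x x′ y y′} → x ≈ x′ → y ≈ y′ → x - y ≈ x′ - y′
  -‿cong₂ x≈x′ y≈y′ = ∙-cong x≈x′ (⁻¹-cong y≈y′)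

  x-0≈x : ∀ x → x - ε ≈ x
  x-0≈x x = ≈-trans (∙-congˡ ε⁻¹≈ε) (identityʳ x)

  x-x≈0 : ∀ {x y} → x ≈ y → x - y ≈ ε
  x-x≈0 {x} {y} x≈y = ≈-trans (∙-congʳ x≈y) (inverseʳ y)

  x-y≈0⇒x≈y : ∀ {x y} → x - y ≈ ε → x ≈ y
  x-y≈0⇒x≈y {x} {y} = x∙y⁻¹≈ε⇒x≈y x y

  x-[x-y]≈y : ∀ x y → x - (x - y) ≈ y
  x-[x-y]≈y x y = begin
    x - (x - y)   ≈⟨ ∙-congˡ (⁻¹-anti-homo‿- x y) ⟩
    x ∙ (y - x)   ≈⟨ assoc x y (x ⁻¹) ⟨
    x ∙ y ∙ x ⁻¹  ≈⟨ xyx⁻¹≈y x y ⟩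
    y             ∎

  ∙-interchange : ∀ x y z w → (x ∙ y) ∙ (z ∙ w) ≈ (x ∙ z) ∙ (y ∙ w)
  ∙-interchange x y z w = begin
    (x ∙ y) ∙ (z ∙ w) ≈⟨ assoc x y (z ∙ w) ⟩
    x ∙ (y ∙ (z ∙ w)) ≈⟨ ∙-congˡ (assoc y z w) ⟨
    x ∙ (y ∙ z ∙ w)   ≈⟨ ∙-congˡ (∙-congʳ (comm y z)) ⟩
    x ∙ (z ∙ y ∙ w)   ≈⟨ ∙-congˡ (assoc z y w) ⟩
    x ∙ (z ∙ (y ∙ w)) ≈⟨ assoc x z (y ∙ w) ⟨
    (x ∙ z) ∙ (y ∙ w) ∎

  [x∙y]-[z∙w] : ∀ x y z w → (x ∙ y) - (z ∙ w) ≈ (x - z) ∙ (y - w)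
  [x∙y]-[z∙w] x y z w = ≈-trans (∙-congˡ (≈-sym (⁻¹-∙-comm z w))) (∙-interchange x y (z ⁻¹) (w ⁻¹))

  [x-y]-[z-w] : ∀ x y z w → (x - y) - (z - w) ≈ (x - z) - (y - w)
  [x-y]-[z-w] x y z w = ≈-trans ([x∙y]-[z∙w] x (y ⁻¹) z (w ⁻¹)) (∙-congˡ (⁻¹-∙-comm y (w ⁻¹)))

-- Products of factors 1 - s, and the vanishing of `P` on all `v ▹ m`.

module Projectors {B : LRB} {a ℓ} (M : BAction B a ℓ) where
  open LRBNotions B
  open LRBOrder B
  open BAction M
  open Subtraction group
  open AbelianGroupProperties group using (ε⁻¹≈ε)
  open SetoidReasoning setoid

  ▹-additive : ∀ b → Additive group group (b ▹_)
  ▹-additive b = record { ⟦⟧-cong = ▹-cong b ; ∙-homo = ▹-+ b }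

  ▹-0 : ∀ b → b ▹ 0# ≈ 0#
  ▹-0 b = Additive.ε-homo (▹-additive b)

  ▹-minus : ∀ b x y → b ▹ (x - y) ≈ b ▹ x - b ▹ y
  ▹-minus b = Additive.minus-homo (▹-additive b)

  id-additive : Additive group group (λ m → m)
  id-additive = record { ⟦⟧-cong = λ p → p ; ∙-homo = λ _ _ → ≈-refl }

  -- The head of the list acts first, so it is the rightmost factor. The order is fixed by the list
  -- because the factors need not commute.
  Π[1-_] : List (Fin n) → Carrier → Carrier
  Π[1- []    ] m = m
  Π[1- s ∷ l ] m = Π[1- l ] (m - s ▹ m)

  Π-cong : ∀ l {m m′} → m ≈ m′ → Π[1- l ] m ≈ Π[1- l ] m′
  Π-cong []      p = p
  Π-cong (s ∷ l) p = Π-cong l (-‿cong₂ p (▹-cong s p))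

  Π-+ : ∀ l m m′ → Π[1- l ] (m + m′) ≈ Π[1- l ] m + Π[1- l ] m′
  Π-+ []      m m′ = ≈-refl
  Π-+ (s ∷ l) m m′ = ≈-trans
    (Π-cong l (≈-trans (-‿cong₂ ≈-refl (▹-+ s m m′)) ([x∙y]-[z∙w] m m′ (s ▹ m) (s ▹ m′))))
    (Π-+ l (m - s ▹ m) (m′ - s ▹ m′))

  Π-additive : ∀ l → Additive group group Π[1- l ]
  Π-additive l = record { ⟦⟧-cong = Π-cong l ; ∙-homo = Π-+ l }

  ▹-[1-s] : ∀ b s m → b ▹ (m - s ▹ m) ≈ b ▹ m - (b · s) ▹ m
  ▹-[1-s] b s m = ≈-trans (▹-minus b m (s ▹ m)) (-‿cong₂ ≈-refl (≈-sym (▹-assoc b s m)))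

  -- Since b (1 - s) m = b m - (b s) m, vanishing on all of `I` survives each factor once `I` is
  -- closed under right multiplication. It is used with `h` the identity and with `h` equal to `P`.
  Π-annihilates : ∀ {h} → Additive group group h → ∀ {p} {I : Fin n → Set p} →
                  (∀ {b} s → I b → I (b · s)) → ∀ l m →
                  (∀ {b} → I b → h (b ▹ m) ≈ 0#) → ∀ {b} → I b → h (b ▹ Π[1- l ] m) ≈ 0#
  Π-annihilates h-additive closed []      m ann = ann
  Π-annihilates {h} h-additive {I = I} closed (s ∷ l) m ann =
    Π-annihilates h-additive closed l (m - s ▹ m) step
    where
    open Additive h-additive
    step : ∀ {b} → I b → h (b ▹ (m - s ▹ m)) ≈ 0#
    step {b} b∈I = begin
      h (b ▹ (m - s ▹ m))           ≈⟨ Additive.⟦⟧-cong h-additive (▹-[1-s] b s m) ⟩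
      h (b ▹ m - (b · s) ▹ m)       ≈⟨ minus-homo (b ▹ m) ((b · s) ▹ m) ⟩
      h (b ▹ m) - h ((b · s) ▹ m)   ≈⟨ -‿cong₂ (ann b∈I) (ann (closed s b∈I)) ⟩
      0# - 0#                       ≈⟨ x-0≈x 0# ⟩
      0#                            ∎

  -- From b s = b follows b (1 - s) = 0. Factors acting before 1 - s only change `m`; those acting
  -- after it are handled by `Π-annihilates`, as the elements below `s` are closed under right
  -- multiplication.
  ▹-Π : ∀ {b s l} m → s ∈ l → b ≤σ s → b ▹ Π[1- l ] m ≈ 0#
  ▹-Π {s = s} {l = s ∷ l} m (here refl) b≤s =
    Π-annihilates id-additive {I = _≤σ s} (λ _ → ≤σ-trans ≤σ-·ˡ) l (m - s ▹ m)
      (λ {b} b≤s → ≈-trans (▹-[1-s] b s m) (x-x≈0 (≈-reflexive (cong (_▹ m) (sym b≤s))))) b≤s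
  ▹-Π {l = t ∷ l} m (there s∈l) b≤s = ▹-Π (m - t ▹ m) s∈l b≤s

  Π-fixes : ∀ l m → (∀ s → s ▹ m ≈ 0#) → Π[1- l ] m ≈ m
  Π-fixes []      m ann = ≈-refl
  Π-fixes (s ∷ l) m ann = ≈-trans (Π-cong l m-sm≈m) (Π-fixes l m ann)
    where
    m-sm≈m : m - s ▹ m ≈ m
    m-sm≈m = ≈-trans (-‿cong₂ ≈-refl (ann s)) (x-0≈x m)

  P : Carrier → Carrier
  P = Π[1- allFin n ]

  open Additive (Π-additive (allFin n)) using () renaming (⟦⟧-cong to P-cong; ε-homo to P-0; minus-homo to P-minus)

  ▹-P : ∀ b m → b ▹ P m ≈ 0#
  ▹-P b m = ▹-Π m (∈-allFin b) ≤σ-refl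

  NotAbove : Fin n → List (Fin n)
  NotAbove v = filter (λ s → ¬? (v ≤σ? s)) (allFin n)

  ▹-Π-NotAbove : ∀ {b v} m → ¬ v ≤σ b → b ▹ Π[1- NotAbove v ] m ≈ 0#
  ▹-Π-NotAbove {b} {v} m v≰b = ▹-Π m (∈-filter⁺ (λ s → ¬? (v ≤σ? s)) (∈-allFin b) v≰b) ≤σ-refl

  ∈-NotAbove : ∀ {s v} → s ∈ NotAbove v → ¬ v ≤σ s
  ∈-NotAbove {v = v} = proj₂ ∘ ∈-filter⁻ (λ s → ¬? (v ≤σ? s)) {xs = allFin n}

  P▹Π-strict : ∀ v l w → (∀ {s} → s ∈ l → v · s <σ v) → (∀ {b} → b <σ v → P (b ▹ w) ≈ 0#) →
               P (v ▹ Π[1- l ] w) ≈ P (v ▹ w)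
  P▹Π-strict v []      w l<v ann = ≈-refl
  P▹Π-strict v (s ∷ l) w l<v ann = begin
    P (v ▹ Π[1- l ] (w - s ▹ w))    ≈⟨ P▹Π-strict v l (w - s ▹ w) (l<v ∘ there) ann′ ⟩
    P (v ▹ (w - s ▹ w))             ≈⟨ P-cong (▹-[1-s] v s w) ⟩
    P (v ▹ w - (v · s) ▹ w)         ≈⟨ P-minus (v ▹ w) ((v · s) ▹ w) ⟩
    P (v ▹ w) - P ((v · s) ▹ w)     ≈⟨ -‿cong₂ ≈-refl (ann (l<v (here refl))) ⟩
    P (v ▹ w) - 0#                  ≈⟨ x-0≈x _ ⟩
    P (v ▹ w)                       ∎
    where
    ann′ : ∀ {b} → b <σ v → P (b ▹ (w - s ▹ w)) ≈ 0#
    -- The product over the one-element list is `w - s ▹ w`.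
    ann′ = Π-annihilates (Π-additive (allFin n)) {I = _<σ v} (λ _ → <σ-≤σ-trans ≤σ-·ˡ) (s ∷ []) w ann

  -- On an element `w` killed by everything not above `y`, only the action of B_{≥σ(y)} remains, and
  -- there connectedness at `y` can be applied.
  PKillsAbove : Fin n → Set (a ⊔ ℓ)
  PKillsAbove y = ∀ w → (∀ b → ¬ y ≤σ b → b ▹ w ≈ 0#) → ∀ v → P (v ▹ w) ≈ 0#

  -- Induction on `v` from below. Multiplying `w` by the factors over `NotAbove v` does not change
  -- `P (v ▹ w)`, because the smaller terms vanish by induction; it makes `w` killed by all elements
  -- not above `v`, so that `PKillsAbove v` applies.
  P▹-lower : ∀ w → (∀ v → v ▹ w ≈ 0# ⊎ PKillsAbove v) → ∀ v → P (v ▹ w) ≈ 0#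
  P▹-lower w alternatives v = go v (<σ-wellFounded v)
    where
    go : ∀ v → Acc _<σ_ v → P (v ▹ w) ≈ 0#
    go v (acc rec) with alternatives v
    ... | inj₁ vw≈0    = ≈-trans (P-cong vw≈0) P-0
    ... | inj₂ pKillsAbove = ≈-trans
      (≈-sym (P▹Π-strict v (NotAbove v) w NotAbove<v (λ {b} b<v → go b (rec b<v))))
      (pKillsAbove (Π[1- NotAbove v ] w) (λ b v≰b → ▹-Π-NotAbove w v≰b) v)
      where
      NotAbove<v : ∀ {s} → s ∈ NotAbove v → v · s <σ v
      NotAbove<v s∈ = ≤σ-·ˡ , λ v≤vs → ∈-NotAbove s∈ (≤σ-trans v≤vs ≤σ-·ʳ)

  module _ (connected : Connected) where

    -- Induction from the largest classes down. Connectedness makes `P (u ▹ w)` the same for all `u`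
    -- above `y`; a second copy of `P` then turns this value into a difference of equal terms.
    pKillsAbove : ∀ y → Acc (flip _<σ_) y → PKillsAbove y
    pKillsAbove y (acc rec) w ann v with y ≤σ? v
    ... | no y≰v  = ≈-trans (P-cong (ann v y≰v)) P-0
    ... | yes y≤v = begin
      -- Every `s` kills the image of `P`, so `P` is idempotent. The inner copy is the product
      -- expanded in `PΠ≈0`; it contains the factor 1 - y.
      P (v ▹ w)        ≈⟨ Π-fixes (allFin n) (P (v ▹ w)) (λ s → ▹-P s (v ▹ w)) ⟨
      P (P (v ▹ w))    ≈⟨ PΠ≈0 v (∈-allFin y) y≤v ⟩
      0#               ∎
      where
      -- As u = v u and v = v v, the difference u w - v w is itself of the form v ▹ (u w - v w), so
      -- `P▹-lower` can be applied to it.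
      edge : ∀ {u v} → y ≤σ u → y ≤σ v → u ≤R v → P (u ▹ w) ≈ P (v ▹ w)
      edge {u} {v} y≤u y≤v u≤v = x-y≈0⇒x≈y (begin
        P (u ▹ w) - P (v ▹ w)     ≈⟨ P-minus (u ▹ w) (v ▹ w) ⟨
        P (u ▹ w - v ▹ w)         ≈⟨ P-cong (-‿cong₂ (≈-reflexive (cong (_▹ w) (sym u≤v)))
                                                     (≈-reflexive (cong (_▹ w) (sym (idem v))))) ⟩
        P ((v · u) ▹ w - (v · v) ▹ w) ≈⟨ P-cong (v▹diff v) ⟨
        P (v ▹ (u ▹ w - v ▹ w))   ≈⟨ P▹-lower (u ▹ w - v ▹ w) alternatives v ⟩
        0#                        ∎)
        where
        v▹diff : ∀ b → b ▹ (u ▹ w - v ▹ w) ≈ (b · u) ▹ w - (b · v) ▹ w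
        v▹diff b = ≈-trans (▹-minus b (u ▹ w) (v ▹ w))
          (-‿cong₂ (≈-sym (▹-assoc b u w)) (≈-sym (▹-assoc b v w)))

        ≰-· : ∀ {b c} → ¬ y ≤σ b → ¬ y ≤σ b · c
        ≰-· y≰b y≤bc = y≰b (≤σ-trans y≤bc ≤σ-·ˡ)

        -- If `b` is not above `y`, neither are b u and b v, and both terms vanish. If `b` is
        -- strictly above `y`, the induction hypothesis applies. If `b` has the class of `y`, then b
        -- u = b = b v and the terms cancel.
        alternatives : ∀ b → b ▹ (u ▹ w - v ▹ w) ≈ 0# ⊎ PKillsAbove b
        alternatives b with y ≤σ? b | b ≤σ? y
        ... | no y≰b  | _       = inj₁ (≈-trans (v▹diff b)
          (≈-trans (-‿cong₂ (ann _ (≰-· y≰b)) (ann _ (≰-· y≰b))) (x-0≈x 0#)))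
        ... | yes y≤b | no b≰y  = inj₂ (pKillsAbove b (rec (y≤b , b≰y)))
        ... | yes y≤b | yes b≤y = inj₁ (≈-trans (v▹diff b)
          (x-x≈0 (≈-reflexive (cong (_▹ w) (trans (≤σ-trans b≤y y≤u) (sym (≤σ-trans b≤y y≤v)))))))

      constant : ∀ {u v} → Star (Edge y) u v → P (u ▹ w) ≈ P (v ▹ w)
      constant ∎ₛ = ≈-refl
      constant ((u≥ , v≥ , inj₁ u≤v) ◅ path) =
        ≈-trans (edge (∈B≥⇒≤σ u≥) (∈B≥⇒≤σ v≥) u≤v) (constant path)
      constant ((u≥ , v≥ , inj₂ v≤u) ◅ path) =
        ≈-trans (≈-sym (edge (∈B≥⇒≤σ v≥) (∈B≥⇒≤σ u≥) v≤u)) (constant path)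

      constant′ : ∀ {u v} → y ≤σ u → y ≤σ v → P (u ▹ w) ≈ P (v ▹ w)
      constant′ y≤u y≤v = constant (connected y _ _ (≤σ⇒∈B≥ y≤u) (≤σ⇒∈B≥ y≤v))

      PΠ-split : ∀ l s b → P (Π[1- l ] (b ▹ w - s ▹ (b ▹ w))) ≈
                           P (Π[1- l ] (b ▹ w)) - P (Π[1- l ] ((s · b) ▹ w))
      PΠ-split l s b = ≈-trans
        (P-cong (≈-trans (Π-cong l (-‿cong₂ ≈-refl (≈-sym (▹-assoc s b w))))
                         (Additive.minus-homo (Π-additive l) (b ▹ w) ((s · b) ▹ w))))
        (P-minus (Π[1- l ] (b ▹ w)) (Π[1- l ] ((s · b) ▹ w)))

      PΠ-0 : ∀ l {m} → m ≈ 0# → P (Π[1- l ] m) ≈ 0#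
      PΠ-0 l m≈0 = ≈-trans (P-cong (≈-trans (Π-cong l m≈0) (Additive.ε-homo (Π-additive l)))) P-0

      -- A factor 1 - s splits the value into terms at `b` and `s · b`. For `s` above `y` the
      -- product `s · b` is again above `y`; otherwise the second term is zero.
      PΠ-constant : ∀ l {b c} → y ≤σ b → y ≤σ c → P (Π[1- l ] (b ▹ w)) ≈ P (Π[1- l ] (c ▹ w))
      PΠ-constant []      y≤b y≤c = constant′ y≤b y≤c
      PΠ-constant (s ∷ l) {b} {c} y≤b y≤c with y ≤σ? s
      ... | yes y≤s = begin
        P (Π[1- l ] (b ▹ w - s ▹ (b ▹ w)))                  ≈⟨ PΠ-split l s b ⟩
        P (Π[1- l ] (b ▹ w)) - P (Π[1- l ] ((s · b) ▹ w))
          ≈⟨ -‿cong₂ (PΠ-constant l y≤b y≤c) (PΠ-constant l (≤σ-glb y≤s y≤b) (≤σ-glb y≤s y≤c)) ⟩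
        P (Π[1- l ] (c ▹ w)) - P (Π[1- l ] ((s · c) ▹ w))   ≈⟨ PΠ-split l s c ⟨
        P (Π[1- l ] (c ▹ w - s ▹ (c ▹ w)))                  ∎
      ... | no y≰s = begin
        P (Π[1- l ] (b ▹ w - s ▹ (b ▹ w)))                  ≈⟨ PΠ-split l s b ⟩
        P (Π[1- l ] (b ▹ w)) - P (Π[1- l ] ((s · b) ▹ w))
          ≈⟨ -‿cong₂ (PΠ-constant l y≤b y≤c)
               (≈-trans (PΠ-0 l (ann _ (y≰s·))) (≈-sym (PΠ-0 l (ann _ y≰s·)))) ⟩
        P (Π[1- l ] (c ▹ w)) - P (Π[1- l ] ((s · c) ▹ w))   ≈⟨ PΠ-split l s c ⟨
        P (Π[1- l ] (c ▹ w - s ▹ (c ▹ w)))                  ∎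
        where
        y≰s· : ∀ {d} → ¬ y ≤σ s · d
        y≰s· y≤sd = y≰s (≤σ-trans y≤sd ≤σ-·ˡ)

      -- Factors 1 - t with `t` not above `y` act trivially. The first one with `t` above `y` gives
      -- a difference of two values that agree by `PΠ-constant`; at the latest this happens at `y`
      -- itself.
      PΠ≈0 : ∀ {l} b → y ∈ l → y ≤σ b → P (Π[1- l ] (b ▹ w)) ≈ 0#
      PΠ≈0 {y ∷ l} b (here refl) y≤b = ≈-trans (PΠ-split l y b)
        (x-x≈0 (PΠ-constant l y≤b (≤σ-glb ≤σ-refl y≤b)))
      PΠ≈0 {t ∷ l} b (there y∈l) y≤b with y ≤σ? t
      ... | yes y≤t = ≈-trans (PΠ-split l t b)
        (x-x≈0 (PΠ-constant l y≤b (≤σ-glb y≤t y≤b)))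
      ... | no  y≰t = ≈-trans (PΠ-split l t b)
        (≈-trans (-‿cong₂ (PΠ≈0 b y∈l y≤b)
                          (PΠ-0 l (ann _ (λ y≤tb → y≰t (≤σ-trans y≤tb ≤σ-·ˡ)))))
                 (x-0≈x 0#))

    P▹≈0 : ∀ v m → P (v ▹ m) ≈ 0#
    P▹≈0 v m = P▹-lower m (λ b → inj₂ (pKillsAbove b (<σ-noetherian b))) v

-- Tuples: last entries, faces and repetitions.

top : ∀ {a} {A : Set a} {k} → Vec A (suc k) → A
top (z ∷ [])    = z
top (_ ∷ w ∷ v) = top (w ∷ v)

top-map : ∀ {a b} {A : Set a} {B : Set b} (f : A → B) {k} (v : Vec A (suc k)) → top (Vec.map f v) ≡ f (top v)
top-map f (z ∷ [])    = refl
top-map f (_ ∷ w ∷ v) = top-map f (w ∷ v)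

All-top : ∀ {a p} {A : Set a} {P : A → Set p} {k} {v : Vec A (suc k)} → All P v → P (top v)
All-top {v = _ ∷ []}    (p ∷ [])     = p
All-top {v = _ ∷ _ ∷ _} (_ ∷ p ∷ ps) = All-top (p ∷ ps)

All-removeAt : ∀ {a p} {A : Set a} {P : A → Set p} {k} {v : Vec A (suc k)} → All P v → ∀ i → All P (removeAt v i)
All-removeAt (_ ∷ ps)     zero    = ps
All-removeAt (p ∷ q ∷ ps) (suc i) = p ∷ All-removeAt (q ∷ ps) i

Linked-removeAt : ∀ {a r} {A : Set a} {R : A → A → Set r} → (∀ {u v w} → R u v → R v w → R u w) →
                  ∀ {k} {v : Vec A (suc k)} → Linked R v → ∀ i → Linked R (removeAt v i)
Linked-removeAt tr [-]                    zero          = []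
Linked-removeAt tr (_ ∷ rs)               zero          = rs
Linked-removeAt tr (r ∷ [-])              (suc zero)    = [-]
Linked-removeAt tr (r ∷ r′ ∷ rs)          (suc zero)    = tr r r′ ∷ rs
Linked-removeAt tr {v = _ ∷ _ ∷ _ ∷ _} (r ∷ rs) (suc (suc i)) = r ∷ Linked-removeAt tr rs (suc i)

-- Two equal neighbours: the only way in which a weakly increasing tuple fails to be strictly
-- increasing, and a property that every map preserves.
data HasRepeat {a} {A : Set a} : ∀ {k} → Vec A k → Set a where
  here  : ∀ {k z} {v : Vec A k} → HasRepeat (z ∷ z ∷ v)
  there : ∀ {k z} {v : Vec A k} → HasRepeat v → HasRepeat (z ∷ v)

HasRepeat-map : ∀ {a b} {A : Set a} {B : Set b} {f : A → B} {k} {v : Vec A k} → HasRepeat v → HasRepeat (Vec.map f v)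
HasRepeat-map here      = here
HasRepeat-map (there r) = there (HasRepeat-map r)

-- Chains in B_{≥X} and their translates.

module Tuples (B : LRB) (x : Fin (LRB.n B)) where
  open LRBNotions B
  open LRBOrder B

  ≤R-trans : ∀ {u v w} → u ≤R v → v ≤R w → u ≤R w
  ≤R-trans {u} {v} {w} u≤v v≤w = begin
    w · u       ≡⟨ cong (w ·_) u≤v ⟨
    w · (v · u) ≡⟨ assoc w v u ⟨
    w · v · u   ≡⟨ cong (_· u) v≤w ⟩
    v · u       ≡⟨ u≤v ⟩
    u           ∎
    where open ≡-Reasoning

  ≤R-antisym : ∀ {u v} → u ≤R v → v ≤R u → u ≡ v
  ≤R-antisym {u} {v} u≤v v≤u = begin
    u         ≡⟨ u≤v ⟨
    v · u     ≡⟨ cong (_· u) v≤u ⟨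
    u · v · u ≡⟨ leftReg u v ⟩
    u · v     ≡⟨ v≤u ⟩
    v         ∎
    where open ≡-Reasoning

  <R-trans : ∀ {u v w} → u <R v → v <R w → u <R w
  <R-trans (u≤v , u≢v) (v≤w , _) = ≤R-trans u≤v v≤w , λ { refl → u≢v (≤R-antisym u≤v v≤w) }

  ·-monoʳ-≤R : ∀ b {u v} → u ≤R v → (b · u) ≤R (b · v)
  ·-monoʳ-≤R b {u} {v} u≤v = begin
    b · v · (b · u)   ≡⟨ assoc (b · v) b u ⟨
    b · v · b · u     ≡⟨ cong (_· u) (leftReg b v) ⟩
    b · v · u         ≡⟨ assoc b v u ⟩
    b · (v · u)       ≡⟨ cong (b ·_) u≤v ⟩
    b · u             ∎
    where open ≡-Reasoning

  ·-≤R : ∀ b u → (b · u) ≤R b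
  ·-≤R b u = trans (sym (assoc b b u)) (cong (_· u) (idem b))

  infixr 8 _·ᵛ_
  _·ᵛ_ : ∀ {k} → Fin n → Vec (Fin n) k → Vec (Fin n) k
  b ·ᵛ v = Vec.map (b ·_) v

  ·ᵛ-assoc : ∀ {k} a b (v : Vec (Fin n) k) → (a · b) ·ᵛ v ≡ a ·ᵛ b ·ᵛ v
  ·ᵛ-assoc a b v = trans (Vec.map-cong (assoc a b) v) (Vec.map-∘ (a ·_) (b ·_) v)

  -- Left multiplication preserves the R-order but not strictness, so translates of chains are in
  -- general only weak chains.
  IsWeakChain : ∀ {k} → Vec (Fin n) k → Set
  IsWeakChain v = All (_∈B≥ x) v × Linked _≤R_ v

  chain⇒weak : ∀ {k} {v : Vec (Fin n) k} → IsChain x v → IsWeakChain v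
  chain⇒weak (≥x , linked) = ≥x , Linked.map proj₁ linked

  weak⇒chain⊎repeat : ∀ {k} {v : Vec (Fin n) k} → IsWeakChain v → IsChain x v ⊎ HasRepeat v
  weak⇒chain⊎repeat {v = v} (≥x , linked) = map₁ (≥x ,_) (go linked)
    where
    go : ∀ {k} {v : Vec (Fin n) k} → Linked _≤R_ v → Linked _<R_ v ⊎ HasRepeat v
    go []  = inj₁ []
    go [-] = inj₁ [-]
    go {v = u ∷ w ∷ v} (u≤w ∷ linked) with u ≟F w | go linked
    ... | yes refl | _       = inj₂ here
    ... | no u≢w   | inj₁ ls = inj₁ ((u≤w , u≢w) ∷ ls)
    ... | no u≢w   | inj₂ r  = inj₂ (there r)

  repeat⇒¬chain : ∀ {k} {v : Vec (Fin n) k} → HasRepeat v → ¬ IsChain x v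
  repeat⇒¬chain r (_ , linked) = go r linked
    where
    go : ∀ {k} {v : Vec (Fin n) k} → HasRepeat v → ¬ Linked _<R_ v
    go here      ((_ , u≢u) ∷ _) = u≢u refl
    go (there r) (_ ∷ linked)    = go r linked
    go (there ()) [-]

  chain-removeAt : ∀ {k} {v : Vec (Fin n) (suc k)} → IsChain x v → ∀ i → IsChain x (removeAt v i)
  chain-removeAt (≥x , linked) i = All-removeAt ≥x i , Linked-removeAt <R-trans linked i

  ·-∈B≥ : ∀ {a b} → a ∈B≥ x → b ∈B≥ x → (a · b) ∈B≥ x
  ·-∈B≥ a≥ b≥ = ≤σ⇒∈B≥ (≤σ-glb (∈B≥⇒≤σ a≥) (∈B≥⇒≤σ b≥))

  ∈B≥-·ˡ : ∀ {a b} → (a · b) ∈B≥ x → a ∈B≥ x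
  ∈B≥-·ˡ ab≥ = ≤σ⇒∈B≥ (≤σ-trans (∈B≥⇒≤σ ab≥) ≤σ-·ˡ)

  ∈B≥-·ʳ : ∀ {a b} → (a · b) ∈B≥ x → b ∈B≥ x
  ∈B≥-·ʳ ab≥ = ≤σ⇒∈B≥ (≤σ-trans (∈B≥⇒≤σ ab≥) ≤σ-·ʳ)

  weak-·ᵛ : ∀ {k b} {v : Vec (Fin n) k} → b ∈B≥ x → IsWeakChain v → IsWeakChain (b ·ᵛ v)
  weak-·ᵛ {b = b} b≥ (≥x , linked) =
    All.map⁺ (All.map (·-∈B≥ b≥) ≥x) , Linked.map⁺ (Linked.map (·-monoʳ-≤R b) linked)

  weak-snoc : ∀ {k b} {v : Vec (Fin n) k} → b ∈B≥ x → IsWeakChain v → IsWeakChain ((b ·ᵛ v) ∷ʳ b)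
  weak-snoc {b = b} b≥ w = All-snoc (proj₁ bw) , Linked-snoc (proj₂ w)
    where
    bw = weak-·ᵛ b≥ w
    All-snoc : ∀ {k} {v : Vec (Fin n) k} → All (_∈B≥ x) v → All (_∈B≥ x) (v ∷ʳ b)
    All-snoc []       = b≥ ∷ []
    All-snoc (p ∷ ps) = p ∷ All-snoc ps
    Linked-snoc : ∀ {k} {v : Vec (Fin n) k} → Linked _≤R_ v → Linked _≤R_ ((b ·ᵛ v) ∷ʳ b)
    Linked-snoc []  = [-]
    Linked-snoc [-] = ·-≤R b _ ∷ [-]
    Linked-snoc {v = u ∷ w ∷ v} (u≤w ∷ linked) = ·-monoʳ-≤R b u≤w ∷ Linked-snoc linked

  chain-·ᵛ⁻ : ∀ {k b} {v : Vec (Fin n) k} → IsWeakChain v → IsChain x (b ·ᵛ v) → IsChain x v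
  chain-·ᵛ⁻ w bv-chain with weak⇒chain⊎repeat w
  ... | inj₁ v-chain = v-chain
  ... | inj₂ r       = contradiction bv-chain (repeat⇒¬chain (HasRepeat-map r))

  -- Here a b u = a u = u: multiplication by `a` undoes multiplication by `b` on entries below `a`.
  ·ᵛ-fixes : ∀ {k a b} {v : Vec (Fin n) k} → All (_≤R a) v → a ≤σ b → a ·ᵛ b ·ᵛ v ≡ v
  ·ᵛ-fixes [] a≤b = refl
  ·ᵛ-fixes {a = a} {b} {u ∷ v} (u≤a ∷ ≤a) a≤b = cong₂ _∷_
    (trans (sym (assoc a b u)) (trans (cong (_· u) a≤b) u≤a)) (·ᵛ-fixes ≤a a≤b)

  ≤R-top : ∀ {k} {v : Vec (Fin n) (suc k)} → IsChain x v → All (_≤R top v) v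
  ≤R-top (_ , linked) = go linked
    where
    go : ∀ {k} {v : Vec (Fin n) (suc k)} → Linked _<R_ v → All (_≤R top v) v
    go {v = z ∷ []}    [-] = idem z ∷ []
    go {v = z ∷ w ∷ v} ((z≤w , _) ∷ linked) with go linked
    ... | w≤ ∷ v≤ = ≤R-trans z≤w w≤ ∷ w≤ ∷ v≤

  top-·ᵛ-fixes : ∀ {k b} {v : Vec (Fin n) (suc k)} → IsChain x v → top v ≤σ b → top v ·ᵛ b ·ᵛ v ≡ v
  top-·ᵛ-fixes v-chain = ·ᵛ-fixes (≤R-top v-chain)

  top·ᵛ≡ : ∀ {k} {v : Vec (Fin n) (suc k)} → IsChain x v → top v ·ᵛ v ≡ v
  top·ᵛ≡ {v = v} v-chain = trans (cong (_·ᵛ v) (sym (idem (top v))))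
    (trans (·ᵛ-assoc (top v) (top v) v) (top-·ᵛ-fixes v-chain ≤σ-refl))

  top-∈B≥ : ∀ {k} {v : Vec (Fin n) (suc k)} → IsChain x v → top v ∈B≥ x
  top-∈B≥ (≥x , _) = All-top ≥x

  -- If `b` identified two neighbours, they would remain equal after multiplication by `top v`,
  -- which gives back the chain `v`.
  chain-·ᵛ : ∀ {k b} {v : Vec (Fin n) (suc k)} → IsChain x v → top v ≤σ b → IsChain x (b ·ᵛ v)
  chain-·ᵛ {b = b} {v} v-chain top≤b = chain-·ᵛ⁻ {b = top v} (weak-·ᵛ b≥ (chain⇒weak v-chain))
    (subst (IsChain x) (sym (top-·ᵛ-fixes v-chain top≤b)) v-chain)
    where
    b≥ : b ∈B≥ x
    b≥ = ≤σ⇒∈B≥ (≤σ-trans (∈B≥⇒≤σ (top-∈B≥ v-chain)) top≤b)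

-- Alternating sums over the faces of a tuple.

module Alternating {a ℓ} (G : AbelianGroup a ℓ) {i} (A : Set i) where
  open AbelianGroup G renaming (ε to 0#; _∙_ to _+_; refl to ≈-refl; sym to ≈-sym; trans to ≈-trans)
  open AbelianGroupProperties G
  open Subtraction G
  open SetoidReasoning setoid

  -- The simplicial coboundary, by recursion on the tuple: the face without `z` has sign plus, and
  -- every other face keeps `z` and receives one more sign.
  alt : ∀ {k} → (Vec A k → Carrier) → Vec A (suc k) → Carrier
  alt {zero}  F (z ∷ [])    = F []
  alt {suc k} F (z ∷ w ∷ v) = F (w ∷ v) - alt (F ∘ (z ∷_)) (w ∷ v)

  alt-cong : ∀ {k} {F F′ : Vec A k → Carrier} (v : Vec A (suc k)) →
             (∀ i → F (removeAt v i) ≈ F′ (removeAt v i)) → alt F v ≈ alt F′ v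
  alt-cong (z ∷ [])    p = p zero
  alt-cong (z ∷ w ∷ v) p = -‿cong₂ (p zero) (alt-cong (w ∷ v) (p ∘ suc))

  alt-minus : ∀ {k} (F F′ : Vec A k → Carrier) (v : Vec A (suc k)) →
              alt (λ u → F u - F′ u) v ≈ alt F v - alt F′ v
  alt-minus F F′ (z ∷ [])    = ≈-refl
  alt-minus F F′ (z ∷ w ∷ v) = ≈-trans
    (-‿cong₂ ≈-refl (alt-minus (F ∘ (z ∷_)) (F′ ∘ (z ∷_)) (w ∷ v)))
    ([x-y]-[z-w] _ _ _ _)

  -- The faces that drop `z` first and those that drop it second both contribute `alt F v`, with
  -- opposite signs. What remains is the same double sum for the shorter tuple.
  alt-alt : ∀ {k} (F : Vec A k → Carrier) (v : Vec A (suc (suc k))) → alt (alt F) v ≈ 0#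
  alt-alt F (z ∷ w ∷ [])        = x-x≈0 ≈-refl
  alt-alt F (z ∷ v@(w ∷ _ ∷ _)) = begin
    alt F v - alt (alt F ∘ (z ∷_)) v
      ≈⟨ -‿cong₂ ≈-refl (alt-cong {F = alt F ∘ (z ∷_)} {F′} v (λ i → alt-∷ (removeAt v i))) ⟩
    alt F v - alt F′ v                             ≈⟨ -‿cong₂ ≈-refl (alt-minus F (alt (F ∘ (z ∷_))) v) ⟩
    alt F v - (alt F v - alt (alt (F ∘ (z ∷_))) v) ≈⟨ x-[x-y]≈y _ _ ⟩
    alt (alt (F ∘ (z ∷_))) v                       ≈⟨ alt-alt (F ∘ (z ∷_)) v ⟩
    0#                                             ∎
    where
    F′ = λ u → F u - alt (F ∘ (z ∷_)) u
    -- `alt` unfolds only on a visibly nonempty tail, hence the match on `u`.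
    alt-∷ : ∀ u → alt F (z ∷ u) ≈ F u - alt (F ∘ (z ∷_)) u
    alt-∷ (_ ∷ _) = ≈-refl

  alt-0 : ∀ {k} (v : Vec A (suc k)) → alt (λ _ → 0#) v ≈ 0#
  alt-0 (z ∷ [])    = ≈-refl
  alt-0 (z ∷ w ∷ v) = ≈-trans (-‿cong₂ ≈-refl (alt-0 (w ∷ v))) (x-0≈x 0#)

  -- Omitting either of the two equal neighbours gives the same face with opposite signs; all other
  -- faces keep the repetition.
  alt-repeat : ∀ {k} (F : Vec A k → Carrier) → (∀ {v} → HasRepeat v → F v ≈ 0#) →
               ∀ {v} → HasRepeat v → alt F v ≈ 0#
  alt-repeat F F-repeat {z ∷ z ∷ []}    here = x-x≈0 ≈-refl
  alt-repeat F F-repeat {z ∷ z ∷ w ∷ v} here = begin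
    F (z ∷ w ∷ v) - (F (z ∷ w ∷ v) - alt (F ∘ (z ∷_) ∘ (z ∷_)) (w ∷ v)) ≈⟨ x-[x-y]≈y _ _ ⟩
    alt (F ∘ (z ∷_) ∘ (z ∷_)) (w ∷ v) ≈⟨ alt-cong (w ∷ v) (λ i → F-repeat here) ⟩
    alt (λ _ → 0#) (w ∷ v)            ≈⟨ alt-0 (w ∷ v) ⟩
    0#                                ∎
  alt-repeat F F-repeat {z ∷ w ∷ v} (there r) = ≈-trans
    (-‿cong₂ (F-repeat r) (alt-repeat (F ∘ (z ∷_)) (F-repeat ∘ there) r)) (x-0≈x 0#)

  alt-map : ∀ {k} (F : Vec A k → Carrier) (f : A → A) (v : Vec A (suc k)) →
            alt (F ∘ Vec.map f) v ≈ alt F (Vec.map f v)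
  alt-map F f (z ∷ [])    = ≈-refl
  alt-map F f (z ∷ w ∷ v) = -‿cong₂ ≈-refl (alt-map (F ∘ (f z ∷_)) f (w ∷ v))

  sign : ℕ → Carrier → Carrier
  sign zero    m = m
  sign (suc k) m = sign k m ⁻¹

  sign-cong : ∀ k {m m′} → m ≈ m′ → sign k m ≈ sign k m′
  sign-cong zero    p = p
  sign-cong (suc k) p = ⁻¹-cong (sign-cong k p)

  sign-0 : ∀ k → sign k 0# ≈ 0#
  sign-0 zero    = ≈-refl
  sign-0 (suc k) = ≈-trans (⁻¹-cong (sign-0 k)) ε⁻¹≈ε

  sign-+ : ∀ k m m′ → sign k (m + m′) ≈ sign k m + sign k m′
  sign-+ zero    m m′ = ≈-refl
  sign-+ (suc k) m m′ = ≈-trans (⁻¹-cong (sign-+ k m m′)) (≈-sym (⁻¹-∙-comm _ _))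

  -- The faces of a cone: those that keep the apex `b` are cones over faces, and the one that omits
  -- it is the base, signed by its position.
  alt-snoc : ∀ {k} (F : Vec A (suc k) → Carrier) b (v : Vec A (suc k)) →
             alt F (v ∷ʳ b) ≈ alt (λ u → F (u ∷ʳ b)) v + sign (suc k) (F v)
  alt-snoc F b (z ∷ [])      = ≈-refl
  alt-snoc {suc k} F b (z ∷ w ∷ v) = begin
    F ((w ∷ v) ∷ʳ b) - alt (F ∘ (z ∷_)) ((w ∷ v) ∷ʳ b)
      ≈⟨ -‿cong₂ ≈-refl (alt-snoc (F ∘ (z ∷_)) b (w ∷ v)) ⟩
    F ((w ∷ v) ∷ʳ b) - (alt (λ u → F (z ∷ (u ∷ʳ b))) (w ∷ v) + sign (suc k) (F (z ∷ w ∷ v)))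
      ≈⟨ ∙-congˡ (⁻¹-∙-comm _ _) ⟨
    F ((w ∷ v) ∷ʳ b) + (alt (λ u → F (z ∷ (u ∷ʳ b))) (w ∷ v) ⁻¹ + sign (suc (suc k)) (F (z ∷ w ∷ v)))
      ≈⟨ assoc _ _ _ ⟨
    alt (λ u → F (u ∷ʳ b)) (z ∷ w ∷ v) + sign (suc (suc k)) (F (z ∷ w ∷ v)) ∎

-- Named forms of the operations on chains, and the cone operator.

module Unfolding {c ℓ : Level} (R : CommutativeRing c ℓ) (B : LRB) (x : Fin (LRB.n B)) where
  open CommutativeRing R using (_*_; 0#) renaming (Carrier to K)
  open LRBNotions B
  open ChainComplex R B x

  actOne : ∀ {k} → Fin n → K × Vec (Fin n) k → List (K × Vec (Fin n) k)
  actOne b (r , v) with b ∈B≥? x | isChain? x v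
  ... | yes _ | yes _ = (r , Vec.map (b ·_) v) ∷ []
  ... | _     | _     = []

  faces : ∀ {k} → K × Vec (Fin n) (suc k) → List (K × Vec (Fin n) k)
  faces (r , v) with isChain? x v
  ... | no _  = []
  ... | yes _ = List.map (λ i → sgn (toℕ i) r , removeAt v i) (allFin _)

  pick : ∀ {q} → Vec (Fin n) (suc q) → K × Vec (Fin n) (suc q) → K
  pick s (r , v) with ≡-dec _≟F_ v s
  ... | yes _ = r
  ... | no  _ = 0#

  valueAt : ∀ {q} → Vec (Fin n) (suc q) → Chains q → K
  valueAt s f with isChain? x s
  ... | no _  = 0#
  ... | yes _ = Σ𝕜 (List.map (pick s) f)

  augment : K × Vec (Fin n) 1 → K
  augment (r , v) with isChain? x v
  ... | yes _ = r
  ... | no  _ = 0#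

  actK : Fin n → K → K
  actK b r with b ∈B≥? x
  ... | yes _ = r
  ... | no  _ = 0#

  coneOne : ∀ {k} → Fin n → K × Vec (Fin n) k → List (K × Vec (Fin n) (suc k))
  coneOne b (r , v) with b ∈B≥? x | isChain? x v
  ... | yes _ | yes _ = (r , Vec.map (b ·_) v ∷ʳ b) ∷ []
  ... | _     | _     = []

  -- Chain homotopy between the action of b and 0: the image of b lies below b,
  -- so it is a cone with apex b.
  cone : ∀ {k} → Fin n → List (K × Vec (Fin n) k) → List (K × Vec (Fin n) (suc k))
  cone b = concatMap (coneOne b)

  -- actC, ∂, coeff and ε are defined by local functions that have no name from
  -- outside; the `_` in each block is such a function, found by unification
  -- when the first equation of the block is checked.
  mutual
    actC≡ : ∀ {q} b (f : Chains q) → actC b f ≡ concatMap (actOne b) f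
    actC≡ b f = List.concatMap-cong (act1≡ b f) f

    act1≡ : ∀ {q} b (f : Chains q) (p : K × Vec (Fin n) (suc q)) → _ ≡ actOne b p
    act1≡ b f (r , v) with b ∈B≥? x | isChain? x v
    ... | yes _ | yes _ = refl
    ... | yes _ | no _  = refl
    ... | no _  | _     = refl

  mutual
    ∂≡ : ∀ {q} (f : Chains (suc q)) → ∂ f ≡ concatMap faces f
    ∂≡ f = List.concatMap-cong (faces≡ f) f

    faces≡ : ∀ {q} (f : Chains (suc q)) (p : K × Vec (Fin n) (suc (suc q))) → _ ≡ faces p
    faces≡ f (r , v) with isChain? x v
    ... | yes _ = refl
    ... | no _  = refl

  mutual
    coeff≡ : ∀ {q} (f : Chains q) s → coeff f s ≡ valueAt s f
    coeff≡ f s with isChain? x s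
    ... | yes c = cong Σ𝕜 (List.map-cong (pick≡ f s c) f)
    ... | no _  = refl

    pick≡ : ∀ {q} (f : Chains q) s (c : IsChain x s) p → _ ≡ pick s p
    pick≡ f s c (r , v) with ≡-dec _≟F_ v s
    ... | yes _ = refl
    ... | no _  = refl

  mutual
    ε≡ : ∀ f → ε f ≡ Σ𝕜 (List.map augment f)
    ε≡ f = cong Σ𝕜 (List.map-cong (val≡ f) f)

    val≡ : ∀ (f : Chains 0) p → _ ≡ augment p
    val≡ f (r , v) with isChain? x v
    ... | yes _ = refl
    ... | no _  = refl

  act𝕜X≡ : ∀ b r → RawKBModule._▹_ 𝕜X b r ≡ actK b r
  act𝕜X≡ b r with b ∈B≥? x
  ... | yes _ = refl
  ... | no _  = refl

-- Finite sums over indices and over tuples.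

module FiniteSums {a ℓ} (M : CommutativeMonoid a ℓ) where
  open CommutativeMonoid M renaming (_∙_ to _+_; ε to 0#; refl to ≈-refl; sym to ≈-sym; trans to ≈-trans)
  open MonoidSum M
  open SetoidReasoning setoid

  sum-single : ∀ {n} (t : Fin n → Carrier) i → (∀ j → ¬ j ≡ i → t j ≈ 0#) → sum t ≈ t i
  sum-single {suc n} t i t≈0 = begin
    sum t                             ≈⟨ sum-remove {i = i} t ⟩
    t i + sum (λ j → t (punchIn i j)) ≈⟨ ∙-congˡ (sum-cong-≋ (λ j → t≈0 _ (punchInᵢ≢i i j))) ⟩
    t i + sum {n} (λ _ → 0#)          ≈⟨ ∙-congˡ (sum-replicate-zero n) ⟩
    t i + 0#                          ≈⟨ identityʳ (t i) ⟩
    t i                               ∎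

  module _ {n : ℕ} where

    sumVec : ∀ {k} → (Vec (Fin n) k → Carrier) → Carrier
    sumVec {zero}  F = F []
    sumVec {suc k} F = sum (λ z → sumVec (F ∘ (z ∷_)))

    sumVec-cong : ∀ {k} {F F′ : Vec (Fin n) k → Carrier} → (∀ v → F v ≈ F′ v) → sumVec F ≈ sumVec F′
    sumVec-cong {zero}  p = p []
    sumVec-cong {suc k} p = sum-cong-≋ (λ z → sumVec-cong (p ∘ (z ∷_)))

    sumVec-+ : ∀ {k} (F F′ : Vec (Fin n) k → Carrier) → sumVec (λ v → F v + F′ v) ≈ sumVec F + sumVec F′
    sumVec-+ {zero}  F F′ = ≈-refl
    sumVec-+ {suc k} F F′ = ≈-trans
      (sum-cong-≋ (λ z → sumVec-+ (F ∘ (z ∷_)) (F′ ∘ (z ∷_)))) (∑-distrib-+ (λ z → sumVec (F ∘ (z ∷_))) _)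

    sumVec-0 : ∀ {k} {F : Vec (Fin n) k → Carrier} → (∀ v → F v ≈ 0#) → sumVec F ≈ 0#
    sumVec-0 {zero}  p = p []
    sumVec-0 {suc k} p = ≈-trans (sum-cong-≋ (λ z → sumVec-0 (p ∘ (z ∷_)))) (sum-replicate-zero n)

    sumVec-single : ∀ {k} (F : Vec (Fin n) k → Carrier) v → (∀ u → ¬ u ≡ v → F u ≈ 0#) → sumVec F ≈ F v
    sumVec-single F []      F≈0 = ≈-refl
    sumVec-single F (z ∷ v) F≈0 = ≈-trans
      (sum-single (λ z → sumVec (F ∘ (z ∷_))) z (λ w w≢z → sumVec-0 (λ u → F≈0 (w ∷ u) (w≢z ∘ Vec.∷-injectiveˡ))))
      (sumVec-single (F ∘ (z ∷_)) v (λ u u≢v → F≈0 (z ∷ u) (u≢v ∘ Vec.∷-injectiveʳ)))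

-- Pairing of chains with module-valued cochains, and transposed operations.

module Pairing {c ℓ : Level} (R : CommutativeRing c ℓ) (B : LRB) (x : Fin (LRB.n B))
               {m ℓm : Level} (M : Module R m ℓm) where
  open CommutativeRing R using (_*_; -_) renaming (Carrier to K; refl to K-refl)
  open LRBNotions B
  open LRBOrder B
  open Tuples B x
  open ChainComplex R B x
  open Module M using
    ( Carrierᴹ; _≈ᴹ_; _+ᴹ_; -ᴹ_; _*ₗ_; 0ᴹ; ≈ᴹ-refl; ≈ᴹ-sym; ≈ᴹ-trans; ≈ᴹ-setoid; ≈ᴹ-reflexive
    ; +ᴹ-abelianGroup; +ᴹ-cong; +ᴹ-identityˡ; +ᴹ-identityʳ; +ᴹ-assoc; -ᴹ‿cong
    ; *ₗ-cong; *ₗ-zeroˡ; *ₗ-zeroʳ; *ₗ-distribʳ; *ₗ-distribˡ; *ₗ-assoc )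
  open Unfolding R B x
  open Alternating +ᴹ-abelianGroup (Fin n)
  open AbelianGroupProperties +ᴹ-abelianGroup using (ε⁻¹≈ε; ⁻¹-∙-comm; inverseʳ-unique)
  open Subtraction +ᴹ-abelianGroup using (∙-interchange)
  open FiniteSums (Module.+ᴹ-commutativeMonoid M)
  open SetoidReasoning ≈ᴹ-setoid

  Cochain : ℕ → Set m
  Cochain k = Vec (Fin n) k → Carrierᴹ

  infix 5 ⟨_,_⟩
  -- The linear extension of a cochain. Cochains with values in 𝕜 test equality of chains; those
  -- with values in a 𝕜B-module define maps out of `C q`.
  ⟨_,_⟩ : ∀ {k} → Cochain k → List (K × Vec (Fin n) k) → Carrierᴹ
  ⟨ G , []          ⟩ = 0ᴹ
  ⟨ G , (r , v) ∷ f ⟩ = r *ₗ G v +ᴹ ⟨ G , f ⟩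

  restrict : ∀ {k} → Cochain k → Cochain k
  restrict G v with isChain? x v
  ... | yes _ = G v
  ... | no  _ = 0ᴹ

  restrict-chain : ∀ {k} (G : Cochain k) {v} → IsChain x v → restrict G v ≈ᴹ G v
  restrict-chain G {v} c with isChain? x v
  ... | yes _ = ≈ᴹ-refl
  ... | no ¬c = contradiction c ¬c

  restrict-¬chain : ∀ {k} (G : Cochain k) {v} → ¬ IsChain x v → restrict G v ≈ᴹ 0ᴹ
  restrict-¬chain G {v} ¬c with isChain? x v
  ... | yes c = contradiction c ¬c
  ... | no _  = ≈ᴹ-refl

  -- Tuples that are not chains are zero in `C q`, so a cochain has to vanish on them for its
  -- pairing to respect `_≈C_`.
  Supported : ∀ {k} → Cochain k → Set ℓm
  Supported G = ∀ {v} → ¬ IsChain x v → G v ≈ᴹ 0ᴹ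

  when : Fin n → Carrierᴹ → Carrierᴹ
  when b y with b ∈B≥? x
  ... | yes _ = y
  ... | no  _ = 0ᴹ

  when-∈ : ∀ {b} y → b ∈B≥ x → when b y ≈ᴹ y
  when-∈ {b} y b∈ with b ∈B≥? x
  ... | yes _ = ≈ᴹ-refl
  ... | no b∉ = contradiction b∈ b∉

  when-∉ : ∀ {b} y → ¬ b ∈B≥ x → when b y ≈ᴹ 0ᴹ
  when-∉ {b} y b∉ with b ∈B≥? x
  ... | yes b∈ = contradiction b∈ b∉
  ... | no _   = ≈ᴹ-refl

  -- The transpose of `∂`, as `act*` below is that of `actC`. Both chain operations discard tuples
  -- that are not chains, hence `restrict`.
  d : ∀ {k} → Cochain k → Cochain (suc k)
  d G = restrict (alt G)

  act* : ∀ {k} → Fin n → Cochain k → Cochain k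
  act* b G = restrict (λ v → when b (G (b ·ᵛ v)))

  ⟨⟩-cong : ∀ {k} {G G′ : Cochain k} → (∀ v → G v ≈ᴹ G′ v) → ∀ f → ⟨ G , f ⟩ ≈ᴹ ⟨ G′ , f ⟩
  ⟨⟩-cong G≈G′ []            = ≈ᴹ-refl
  ⟨⟩-cong G≈G′ ((r , v) ∷ f) = +ᴹ-cong (*ₗ-cong (CommutativeRing.refl R) (G≈G′ v)) (⟨⟩-cong G≈G′ f)

  ⟨⟩-cong-All : ∀ {k} {G G′ : Cochain k} {e} →
                ListAll.All (λ (_ , v) → G v ≈ᴹ G′ v) e → ⟨ G , e ⟩ ≈ᴹ ⟨ G′ , e ⟩
  ⟨⟩-cong-All []       = ≈ᴹ-refl
  ⟨⟩-cong-All (p ∷ ps) = +ᴹ-cong (*ₗ-cong K-refl p) (⟨⟩-cong-All ps)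

  ⟨⟩-++ : ∀ {k} (G : Cochain k) f g → ⟨ G , f ++ g ⟩ ≈ᴹ ⟨ G , f ⟩ +ᴹ ⟨ G , g ⟩
  ⟨⟩-++ G []            g = ≈ᴹ-sym (+ᴹ-identityˡ _)
  ⟨⟩-++ G ((r , v) ∷ f) g = ≈ᴹ-trans (+ᴹ-cong ≈ᴹ-refl (⟨⟩-++ G f g)) (≈ᴹ-sym (+ᴹ-assoc _ _ _))

  ⟨⟩-• : ∀ {q} (G : Cochain (suc q)) r f → ⟨ G , RawKBModule._•_ (C q) r f ⟩ ≈ᴹ r *ₗ ⟨ G , f ⟩
  ⟨⟩-• G r []            = ≈ᴹ-sym (*ₗ-zeroʳ r)
  ⟨⟩-• G r ((s , v) ∷ f) = ≈ᴹ-trans (+ᴹ-cong (*ₗ-assoc r s (G v)) (⟨⟩-• G r f)) (≈ᴹ-sym (*ₗ-distribˡ r _ _))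

  -- Action, boundary and cone all have the form `concatMap φ`, so their transposes need checking on
  -- a single term only.
  ⟨⟩-concatMap : ∀ {j k} (G : Cochain k) (G′ : Cochain j) (φ : K × Vec (Fin n) j → List (K × Vec (Fin n) k)) →
                 (∀ r v → ⟨ G , φ (r , v) ⟩ ≈ᴹ r *ₗ G′ v) → ∀ f → ⟨ G , concatMap φ f ⟩ ≈ᴹ ⟨ G′ , f ⟩
  ⟨⟩-concatMap G G′ φ p []            = ≈ᴹ-refl
  ⟨⟩-concatMap G G′ φ p ((r , v) ∷ f) = ≈ᴹ-trans (⟨⟩-++ G (φ (r , v)) _) (+ᴹ-cong (p r v) (⟨⟩-concatMap G G′ φ p f))


  ⟨⟩-0 : ∀ {k} {G : Cochain k} → (∀ v → G v ≈ᴹ 0ᴹ) → ∀ f → ⟨ G , f ⟩ ≈ᴹ 0ᴹ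
  ⟨⟩-0 G≈0 []            = ≈ᴹ-refl
  ⟨⟩-0 G≈0 ((r , v) ∷ f) = ≈ᴹ-trans
    (+ᴹ-cong (≈ᴹ-trans (*ₗ-cong K-refl (G≈0 v)) (*ₗ-zeroʳ r)) (⟨⟩-0 G≈0 f)) (+ᴹ-identityˡ 0ᴹ)

  ⟨⟩-+ : ∀ {k} (G G′ : Cochain k) f → ⟨ (λ v → G v +ᴹ G′ v) , f ⟩ ≈ᴹ ⟨ G , f ⟩ +ᴹ ⟨ G′ , f ⟩
  ⟨⟩-+ G G′ []            = ≈ᴹ-sym (+ᴹ-identityˡ 0ᴹ)
  ⟨⟩-+ G G′ ((r , v) ∷ f) = ≈ᴹ-trans (+ᴹ-cong (*ₗ-distribˡ r (G v) (G′ v)) (⟨⟩-+ G G′ f)) (∙-interchange _ _ _ _)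

  -*ₗ : ∀ r y → (- r) *ₗ y ≈ᴹ -ᴹ (r *ₗ y)
  -*ₗ r y = inverseʳ-unique _ _ (≈ᴹ-trans (≈ᴹ-sym (*ₗ-distribʳ y r (- r)))
    (≈ᴹ-trans (*ₗ-cong (CommutativeRing.-‿inverseʳ R r) ≈ᴹ-refl) (*ₗ-zeroˡ y)))

  *ₗ-neg : ∀ r y → r *ₗ (-ᴹ y) ≈ᴹ -ᴹ (r *ₗ y)
  *ₗ-neg r y = inverseʳ-unique _ _ (≈ᴹ-trans (≈ᴹ-sym (*ₗ-distribˡ r y (-ᴹ y)))
    (≈ᴹ-trans (*ₗ-cong K-refl (Module.-ᴹ‿inverseʳ M y)) (*ₗ-zeroʳ r)))

  ⟨⟩-neg : ∀ {k} (G : Cochain k) f → ⟨ (λ v → -ᴹ G v) , f ⟩ ≈ᴹ -ᴹ ⟨ G , f ⟩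
  ⟨⟩-neg G []            = ≈ᴹ-sym ε⁻¹≈ε
  ⟨⟩-neg G ((r , v) ∷ f) = ≈ᴹ-trans (+ᴹ-cong (*ₗ-neg r (G v)) (⟨⟩-neg G f)) (⁻¹-∙-comm _ _)

  ⟨⟩-sign : ∀ {k} j (G : Cochain k) f → ⟨ (λ v → sign j (G v)) , f ⟩ ≈ᴹ sign j ⟨ G , f ⟩
  ⟨⟩-sign zero    G f = ≈ᴹ-refl
  ⟨⟩-sign (suc j) G f = ≈ᴹ-trans (⟨⟩-neg (λ v → sign j (G v)) f) (-ᴹ‿cong (⟨⟩-sign j G f))

  ⟨⟩-actC : ∀ {q} (G : Cochain (suc q)) b f → ⟨ G , actC b f ⟩ ≈ᴹ ⟨ act* b G , f ⟩
  ⟨⟩-actC G b f = ≈ᴹ-trans (≈ᴹ-reflexive (cong (⟨ G ,_⟩) (actC≡ b f)))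
    (⟨⟩-concatMap G (act* b G) (actOne b) one f)
    where
    one : ∀ r v → ⟨ G , actOne b (r , v) ⟩ ≈ᴹ r *ₗ act* b G v
    one r v with isChain? x v | b ∈B≥? x
    ... | yes _ | yes _ = +ᴹ-identityʳ _
    ... | yes _ | no _  = ≈ᴹ-sym (*ₗ-zeroʳ r)
    ... | no _  | yes _ = ≈ᴹ-sym (*ₗ-zeroʳ r)
    ... | no _  | no _  = ≈ᴹ-sym (*ₗ-zeroʳ r)

  ⟨⟩-tabulate-neg : ∀ {j k l} (s : Fin j → K) (u : Fin j → Vec (Fin n) k) (G : Cochain k)
                    (G′ : Cochain l) (u′ : Fin j → Vec (Fin n) l) → (∀ i → G′ (u′ i) ≡ G (u i)) →
                    ⟨ G′ , List.tabulate (λ i → - s i , u′ i) ⟩ ≈ᴹ -ᴹ ⟨ G , List.tabulate (λ i → s i , u i) ⟩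
  ⟨⟩-tabulate-neg {zero}  s u G G′ u′ p = ≈ᴹ-sym ε⁻¹≈ε
  ⟨⟩-tabulate-neg {suc j} s u G G′ u′ p = ≈ᴹ-trans
    (+ᴹ-cong (≈ᴹ-trans (*ₗ-cong K-refl (≈ᴹ-reflexive (p zero))) (-*ₗ (s zero) (G (u zero))))
             (⟨⟩-tabulate-neg (s ∘ suc) (u ∘ suc) G G′ (u′ ∘ suc) (p ∘ suc)))
    (⁻¹-∙-comm _ _)

  ⟨⟩-faces : ∀ {k} (G : Cochain k) r (v : Vec (Fin n) (suc k)) →
             ⟨ G , List.tabulate (λ i → sgn (toℕ i) r , removeAt v i) ⟩ ≈ᴹ r *ₗ alt G v
  ⟨⟩-faces G r (z ∷ [])    = +ᴹ-identityʳ _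
  ⟨⟩-faces G r (z ∷ w ∷ v) = begin
    r *ₗ G (w ∷ v) +ᴹ ⟨ G , List.tabulate (λ i → - sgn (toℕ i) r , z ∷ removeAt (w ∷ v) i) ⟩
      ≈⟨ +ᴹ-cong ≈ᴹ-refl (⟨⟩-tabulate-neg (λ i → sgn (toℕ i) r) (removeAt (w ∷ v)) (G ∘ (z ∷_)) G _ (λ _ → refl)) ⟩
    r *ₗ G (w ∷ v) +ᴹ -ᴹ ⟨ G ∘ (z ∷_) , List.tabulate (λ i → sgn (toℕ i) r , removeAt (w ∷ v) i) ⟩
      ≈⟨ +ᴹ-cong ≈ᴹ-refl (-ᴹ‿cong (⟨⟩-faces (G ∘ (z ∷_)) r (w ∷ v))) ⟩
    r *ₗ G (w ∷ v) +ᴹ -ᴹ (r *ₗ alt (G ∘ (z ∷_)) (w ∷ v))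
      ≈⟨ +ᴹ-cong ≈ᴹ-refl (*ₗ-neg r _) ⟨
    r *ₗ G (w ∷ v) +ᴹ r *ₗ (-ᴹ alt (G ∘ (z ∷_)) (w ∷ v))
      ≈⟨ *ₗ-distribˡ r _ _ ⟨
    r *ₗ alt G (z ∷ w ∷ v) ∎

  ⟨⟩-∂ : ∀ {q} (G : Cochain (suc q)) f → ⟨ G , ∂ f ⟩ ≈ᴹ ⟨ d G , f ⟩
  ⟨⟩-∂ G f = ≈ᴹ-trans (≈ᴹ-reflexive (cong (⟨ G ,_⟩) (∂≡ f))) (⟨⟩-concatMap G (d G) faces one f)
    where
    one : ∀ r v → ⟨ G , faces (r , v) ⟩ ≈ᴹ r *ₗ d G v
    one r v with isChain? x v
    ... | yes _ = ≈ᴹ-trans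
      (≈ᴹ-reflexive (cong (⟨ G ,_⟩) (List.map-tabulate (λ i → i) (λ i → sgn (toℕ i) r , removeAt v i))))
      (⟨⟩-faces G r v)
    ... | no _  = ≈ᴹ-sym (*ₗ-zeroʳ r)

  cone* : ∀ {k} → Fin n → Cochain (suc k) → Cochain k
  cone* b G = restrict (λ v → when b (G ((b ·ᵛ v) ∷ʳ b)))

  ⟨⟩-cone : ∀ {k} (G : Cochain (suc k)) b f → ⟨ G , cone b f ⟩ ≈ᴹ ⟨ cone* b G , f ⟩
  ⟨⟩-cone G b f = ⟨⟩-concatMap G (cone* b G) (coneOne b) one f
    where
    one : ∀ r v → ⟨ G , coneOne b (r , v) ⟩ ≈ᴹ r *ₗ cone* b G v
    one r v with isChain? x v | b ∈B≥? x
    ... | yes _ | yes _ = +ᴹ-identityʳ _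
    ... | yes _ | no _  = ≈ᴹ-sym (*ₗ-zeroʳ r)
    ... | no _  | yes _ = ≈ᴹ-sym (*ₗ-zeroʳ r)
    ... | no _  | no _  = ≈ᴹ-sym (*ₗ-zeroʳ r)

  supported-≈ : ∀ {k} {G G′ : Cochain k} → Supported G → Supported G′ →
                (∀ {v} → IsChain x v → G v ≈ᴹ G′ v) → ∀ v → G v ≈ᴹ G′ v
  supported-≈ sG sG′ p v with isChain? x v
  ... | yes c = p c
  ... | no ¬c = ≈ᴹ-trans (sG ¬c) (≈ᴹ-sym (sG′ ¬c))

  d-supported : ∀ {k} (G : Cochain k) → Supported (d G)
  d-supported G = restrict-¬chain (alt G)

  act*-supported : ∀ {k} b (G : Cochain k) → Supported (act* b G)
  act*-supported b G = restrict-¬chain _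

  cone*-supported : ∀ {k} b (G : Cochain (suc k)) → Supported (cone* b G)
  cone*-supported b G = restrict-¬chain _

  act*-∈ : ∀ {k b} (G : Cochain k) {v} → b ∈B≥ x → IsChain x v → act* b G v ≈ᴹ G (b ·ᵛ v)
  act*-∈ G b∈ c = ≈ᴹ-trans (restrict-chain _ c) (when-∈ _ b∈)

  act*-∉ : ∀ {k b} (G : Cochain k) v → ¬ b ∈B≥ x → act* b G v ≈ᴹ 0ᴹ
  act*-∉ G v b∉ with isChain? x v
  ... | yes _ = when-∉ _ b∉
  ... | no _  = ≈ᴹ-refl

  cone*-∈ : ∀ {k b} (G : Cochain (suc k)) {v} → b ∈B≥ x → IsChain x v → cone* b G v ≈ᴹ G ((b ·ᵛ v) ∷ʳ b)
  cone*-∈ G b∈ c = ≈ᴹ-trans (restrict-chain _ c) (when-∈ _ b∈)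

  -- A weak chain that is not a chain has a repetition, and there the alternating sum vanishes as
  -- well. This handles translates `b ·ᵛ v` that degenerate.
  d-weak : ∀ {k} (G : Cochain k) → Supported G → ∀ {w} → IsWeakChain w → d G w ≈ᴹ alt G w
  d-weak G sG {w} weak with weak⇒chain⊎repeat weak
  ... | inj₁ c = restrict-chain (alt G) c
  ... | inj₂ r = ≈ᴹ-trans (restrict-¬chain (alt G) (repeat⇒¬chain r))
    (≈ᴹ-sym (alt-repeat G (sG ∘ repeat⇒¬chain) r))

  dd≈0 : ∀ {k} (G : Cochain k) v → d (d G) v ≈ᴹ 0ᴹ
  dd≈0 G = supported-≈ (d-supported (d G)) (λ _ → ≈ᴹ-refl) λ {v} c → begin
    d (d G) v      ≈⟨ restrict-chain (alt (d G)) c ⟩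
    alt (d G) v    ≈⟨ alt-cong v (λ i → restrict-chain (alt G) (chain-removeAt c i)) ⟩
    alt (alt G) v  ≈⟨ alt-alt G v ⟩
    0ᴹ             ∎

  act*-d : ∀ {k} b (G : Cochain k) → Supported G → ∀ v → act* b (d G) v ≈ᴹ d (act* b G) v
  act*-d b G sG = supported-≈ (act*-supported b (d G)) (d-supported (act* b G)) (λ c → go c (b ∈B≥? x))
    where
    go : ∀ {v} → IsChain x v → Dec (b ∈B≥ x) → act* b (d G) v ≈ᴹ d (act* b G) v
    go {v} c (yes b∈) = begin
      act* b (d G) v          ≈⟨ act*-∈ (d G) b∈ c ⟩
      d G (b ·ᵛ v)            ≈⟨ d-weak G sG (weak-·ᵛ b∈ (chain⇒weak c)) ⟩
      alt G (b ·ᵛ v)          ≈⟨ alt-map G (b ·_) v ⟨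
      alt (G ∘ (b ·ᵛ_)) v     ≈⟨ alt-cong v (λ i → act*-∈ G b∈ (chain-removeAt c i)) ⟨
      alt (act* b G) v        ≈⟨ restrict-chain (alt (act* b G)) c ⟨
      d (act* b G) v          ∎
    go {v} c (no b∉) = begin
      act* b (d G) v          ≈⟨ act*-∉ (d G) v b∉ ⟩
      0ᴹ                      ≈⟨ alt-0 v ⟨
      alt (λ _ → 0ᴹ) v        ≈⟨ alt-cong v (λ i → act*-∉ G (removeAt v i) b∉) ⟨
      alt (act* b G) v        ≈⟨ restrict-chain (alt (act* b G)) c ⟨
      d (act* b G) v          ∎

  -- The transposed homotopy formula: `alt-snoc` separates the faces of the cone that contain the
  -- apex from the base, which is the translate of `v` by `b`.
  cone*-d : ∀ {k b} → b ∈B≥ x → (G : Cochain (suc k)) → Supported G → ∀ v →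
            cone* b (d G) v ≈ᴹ d (cone* b G) v +ᴹ sign (suc k) (act* b G v)
  cone*-d {k} {b} b∈ G sG = supported-≈ (cone*-supported b (d G))
    (λ ¬c → ≈ᴹ-trans
      (+ᴹ-cong (d-supported (cone* b G) ¬c)
               (≈ᴹ-trans (sign-cong (suc k) (act*-supported b G ¬c)) (sign-0 (suc k))))
      (+ᴹ-identityˡ 0ᴹ))
    λ {v} c → begin
    cone* b (d G) v                     ≈⟨ cone*-∈ (d G) b∈ c ⟩
    d G ((b ·ᵛ v) ∷ʳ b)                 ≈⟨ d-weak G sG (weak-snoc b∈ (chain⇒weak c)) ⟩
    alt G ((b ·ᵛ v) ∷ʳ b)               ≈⟨ alt-snoc G b (b ·ᵛ v) ⟩
    alt (λ u → G (u ∷ʳ b)) (b ·ᵛ v) +ᴹ sign (suc k) (G (b ·ᵛ v))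
      ≈⟨ +ᴹ-cong (alt-map (λ u → G (u ∷ʳ b)) (b ·_) v) (sign-cong (suc k) (act*-∈ G b∈ c)) ⟨
    alt (λ u → G ((b ·ᵛ u) ∷ʳ b)) v +ᴹ sign (suc k) (act* b G v)
      ≈⟨ +ᴹ-cong (alt-cong v (λ i → cone*-∈ G b∈ (chain-removeAt c i))) ≈ᴹ-refl ⟨
    alt (cone* b G) v +ᴹ sign (suc k) (act* b G v)
      ≈⟨ +ᴹ-cong (restrict-chain (alt (cone* b G)) c) ≈ᴹ-refl ⟨
    d (cone* b G) v +ᴹ sign (suc k) (act* b G v) ∎

  act*-assoc : ∀ {k} a b (G : Cochain k) → Supported G → ∀ v → act* (a · b) G v ≈ᴹ act* b (act* a G) v
  act*-assoc a b G sG = supported-≈ (act*-supported (a · b) G) (act*-supported b (act* a G))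
    (λ c → go c (a ∈B≥? x) (b ∈B≥? x))
    where
    go : ∀ {v} → IsChain x v → Dec (a ∈B≥ x) → Dec (b ∈B≥ x) → act* (a · b) G v ≈ᴹ act* b (act* a G) v
    go {v} c _ (no b∉) = ≈ᴹ-trans (act*-∉ G v (b∉ ∘ ∈B≥-·ʳ)) (≈ᴹ-sym (act*-∉ (act* a G) v b∉))
    go {v} c (no a∉) (yes b∈) = begin
      act* (a · b) G v          ≈⟨ act*-∉ G v (a∉ ∘ ∈B≥-·ˡ) ⟩
      0ᴹ                        ≈⟨ act*-∉ G (b ·ᵛ v) a∉ ⟨
      act* a G (b ·ᵛ v)         ≈⟨ act*-∈ (act* a G) b∈ c ⟨
      act* b (act* a G) v       ∎
    go {v} c (yes a∈) (yes b∈) = begin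
      act* (a · b) G v          ≈⟨ act*-∈ G (·-∈B≥ a∈ b∈) c ⟩
      G ((a · b) ·ᵛ v)          ≈⟨ ≈ᴹ-reflexive (cong G (·ᵛ-assoc a b v)) ⟩
      G (a ·ᵛ b ·ᵛ v)           ≈⟨ act*-weak (weak-·ᵛ b∈ (chain⇒weak c)) ⟨
      act* a G (b ·ᵛ v)         ≈⟨ act*-∈ (act* a G) b∈ c ⟨
      act* b (act* a G) v       ∎
      where
      act*-weak : ∀ {w} → IsWeakChain w → act* a G w ≈ᴹ G (a ·ᵛ w)
      act*-weak weak with weak⇒chain⊎repeat weak
      ... | inj₁ c = act*-∈ G a∈ c
      ... | inj₂ r = ≈ᴹ-trans (act*-supported a G (repeat⇒¬chain r)) (≈ᴹ-sym (sG (repeat⇒¬chain (HasRepeat-map r))))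

  -- Collecting equal tuples shows that the pairing depends on `f` only through its coefficients at
  -- chains.
  ⟨⟩-expand : ∀ {q} (G : Cochain (suc q)) → Supported G → ∀ f → ⟨ G , f ⟩ ≈ᴹ sumVec (λ s → valueAt s f *ₗ G s)
  ⟨⟩-expand G sG [] = ≈ᴹ-sym (sumVec-0 zero-value)
    where
    zero-value : ∀ s → valueAt s [] *ₗ G s ≈ᴹ 0ᴹ
    zero-value s with isChain? x s
    ... | yes _ = *ₗ-zeroˡ (G s)
    ... | no _  = *ₗ-zeroˡ (G s)
  ⟨⟩-expand G sG ((r , v) ∷ f) = begin
    r *ₗ G v +ᴹ ⟨ G , f ⟩
      ≈⟨ +ᴹ-cong single (⟨⟩-expand G sG f) ⟩
    sumVec (λ s → pick s (r , v) *ₗ G s) +ᴹ sumVec (λ s → valueAt s f *ₗ G s)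
      ≈⟨ sumVec-+ (λ s → pick s (r , v) *ₗ G s) (λ s → valueAt s f *ₗ G s) ⟨
    sumVec (λ s → pick s (r , v) *ₗ G s +ᴹ valueAt s f *ₗ G s)
      ≈⟨ sumVec-cong split ⟨
    sumVec (λ s → valueAt s ((r , v) ∷ f) *ₗ G s) ∎
    where
    split : ∀ s → valueAt s ((r , v) ∷ f) *ₗ G s ≈ᴹ pick s (r , v) *ₗ G s +ᴹ valueAt s f *ₗ G s
    split s with isChain? x s
    ... | yes _ = *ₗ-distribʳ (G s) _ _
    ... | no ¬c = ≈ᴹ-trans (*ₗ-zeroˡ (G s)) (≈ᴹ-sym (≈ᴹ-trans
      (+ᴹ-cong (≈ᴹ-trans (*ₗ-cong K-refl (sG ¬c)) (*ₗ-zeroʳ _)) (*ₗ-zeroˡ (G s))) (+ᴹ-identityˡ 0ᴹ)))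
    pick-≢ : ∀ s → ¬ s ≡ v → pick s (r , v) *ₗ G s ≈ᴹ 0ᴹ
    pick-≢ s s≢v with ≡-dec _≟F_ v s
    ... | yes v≡s = contradiction (sym v≡s) s≢v
    ... | no _    = *ₗ-zeroˡ (G s)
    pick-≡ : pick v (r , v) *ₗ G v ≈ᴹ r *ₗ G v
    pick-≡ with ≡-dec _≟F_ v v
    ... | yes _   = ≈ᴹ-refl
    ... | no v≢v = contradiction refl v≢v
    single : r *ₗ G v ≈ᴹ sumVec (λ s → pick s (r , v) *ₗ G s)
    single = ≈ᴹ-sym (≈ᴹ-trans (sumVec-single (λ s → pick s (r , v) *ₗ G s) v pick-≢) pick-≡)

  ⟨⟩-cong-≈C : ∀ {q} {G : Cochain (suc q)} → Supported G → ∀ {f g} → f ≈C g → ⟨ G , f ⟩ ≈ᴹ ⟨ G , g ⟩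
  ⟨⟩-cong-≈C {G = G} sG {f} {g} f≈g = begin
    ⟨ G , f ⟩                            ≈⟨ ⟨⟩-expand G sG f ⟩
    sumVec (λ s → valueAt s f *ₗ G s)    ≈⟨ sumVec-cong (λ s → *ₗ-cong (values s) (≈ᴹ-refl {G s})) ⟩
    sumVec (λ s → valueAt s g *ₗ G s)    ≈⟨ ⟨⟩-expand G sG g ⟨
    ⟨ G , g ⟩                            ∎
    where
    values : ∀ s → CommutativeRing._≈_ R (valueAt s f) (valueAt s g)
    values s = subst₂ (CommutativeRing._≈_ R) (coeff≡ f s) (coeff≡ g s) (f≈g s)

-- The chain groups as modules, and exactness of the augmented complex.

module Exactness {c ℓ : Level} (R : CommutativeRing c ℓ) (B : LRB) (x : Fin (LRB.n B)) where
  open CommutativeRing R renaming (Carrier to K; refl to K-refl; sym to K-sym; trans to K-trans) hiding (zero)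
  open LRBNotions B hiding (assoc)
  open LRBOrder B
  open Tuples B x
  open ChainComplex R B x
  open Unfolding R B x
  open Pairing R B x (⟨module⟩ {R = R})
  open Alternating +-abelianGroup (Fin n) using (sign; sign-cong)
  open AbelianGroupProperties +-abelianGroup using (ε⁻¹≈ε)

  δ : ∀ {q} → Vec (Fin n) (suc q) → Cochain (suc q)
  δ s v with isChain? x s
  ... | yes _ = pick s (1# , v)
  ... | no _  = 0#

  pick-* : ∀ {q} (s : Vec (Fin n) (suc q)) r v → pick s (r , v) ≈ r * pick s (1# , v)
  pick-* s r v with ≡-dec _≟F_ v s
  ... | yes _ = K-sym (*-identityʳ r)
  ... | no _  = K-sym (zeroʳ r)

  δ-supported : ∀ {q} (s : Vec (Fin n) (suc q)) → Supported (δ s)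
  δ-supported s {v} ¬c with isChain? x s
  ... | no _ = K-refl
  ... | yes c with ≡-dec _≟F_ v s
  ...   | yes refl = contradiction c ¬c
  ...   | no _     = K-refl

  coeff≈⟨δ⟩ : ∀ {q} (f : Chains q) s → coeff f s ≈ ⟨ δ s , f ⟩
  coeff≈⟨δ⟩ f s = K-trans (reflexive (coeff≡ f s)) (go f)
    where
    go : ∀ f → valueAt s f ≈ ⟨ δ s , f ⟩
    go f with isChain? x s
    ... | no _  = K-sym (⟨⟩-0 (λ _ → K-refl) f)
    ... | yes _ = sum f
      where
      sum : ∀ f → Σ𝕜 (List.map (pick s) f) ≈ ⟨ (λ v → pick s (1# , v)) , f ⟩
      sum []            = K-refl
      sum ((r , v) ∷ f) = +-cong (pick-* s r v) (sum f)

  -- The indicators `δ s` are supported and read off the coefficients. Identities between lists of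
  -- terms thereby follow from pointwise identities of the transposed cochains.
  ≈C-by-cochains : ∀ {q} {f g : Chains q} → (∀ {G : Cochain (suc q)} → Supported G → ⟨ G , f ⟩ ≈ ⟨ G , g ⟩) → f ≈C g
  ≈C-by-cochains {f = f} {g} p s = K-trans (coeff≈⟨δ⟩ f s) (K-trans (p (δ-supported s)) (K-sym (coeff≈⟨δ⟩ g s)))

  infixr 7 _•_
  _•_ : ∀ {q} → K → Chains q → Chains q
  _•_ {q} = RawKBModule._•_ (C q)

  negate : ∀ {q} → Chains q → Chains q
  negate f = (- 1#) • f

  ⟨⟩-negate : ∀ {q} (G : Cochain (suc q)) f → ⟨ G , negate f ⟩ ≈ - ⟨ G , f ⟩
  ⟨⟩-negate G f = K-trans (⟨⟩-• G (- 1#) f) (K-trans (-*ₗ 1# ⟨ G , f ⟩) (-‿cong (*-identityˡ ⟨ G , f ⟩)))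

  chainGroup : ℕ → AbelianGroup c ℓ
  chainGroup q = record
    { Carrier = Chains q
    ; _≈_ = _≈C_
    ; _∙_ = _++_
    ; ε   = []
    ; _⁻¹ = negate
    ; isAbelianGroup = record
      { isGroup = record
        { isMonoid = record
          { isSemigroup = record
            { isMagma = record
              { isEquivalence = record
                { refl  = λ s → K-refl
                ; sym   = λ p s → K-sym (p s)
                ; trans = λ p p′ s → K-trans (p s) (p′ s)
                }
              ; ∙-cong = λ {f} {f′} {g} {g′} f≈f′ g≈g′ → ≈C-by-cochains (λ {G} sG →
                  K-trans (⟨⟩-++ G f g) (K-trans (+-cong (⟨⟩-cong-≈C sG {f} {f′} f≈f′) (⟨⟩-cong-≈C sG {g} {g′} g≈g′))
                    (K-sym (⟨⟩-++ G f′ g′))))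
              }
            ; assoc = λ f g h s → reflexive (cong (λ f → coeff f s) (List.++-assoc f g h))
            }
          ; identity = (λ f s → K-refl) , λ f s → reflexive (cong (λ f → coeff f s) (List.++-identityʳ f))
          }
        ; inverse = (λ f → ≈C-by-cochains (λ {G} _ → K-trans (⟨⟩-++ G (negate f) f)
                      (K-trans (+-congʳ (⟨⟩-negate G f)) (-‿inverseˡ ⟨ G , f ⟩))))
                  , (λ f → ≈C-by-cochains (λ {G} _ → K-trans (⟨⟩-++ G f (negate f))
                      (K-trans (+-congˡ (⟨⟩-negate G f)) (-‿inverseʳ ⟨ G , f ⟩))))
        ; ⁻¹-cong = λ {f} {g} f≈g → ≈C-by-cochains (λ {G} sG →
            K-trans (⟨⟩-negate G f) (K-trans (-‿cong (⟨⟩-cong-≈C sG {f} {g} f≈g)) (K-sym (⟨⟩-negate G g))))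
        }
      ; comm = λ f g → ≈C-by-cochains (λ {G} _ →
          K-trans (⟨⟩-++ G f g) (K-trans (+-comm _ _) (K-sym (⟨⟩-++ G g f))))
      }
    }

  actC-hom-++ : ∀ {q} b (f g : Chains q) → actC b (f ++ g) ≈C (actC b f ++ actC b g)
  actC-hom-++ b f g = ≈C-by-cochains (λ {G} _ → K-trans (⟨⟩-actC G b (f ++ g))
    (K-trans (⟨⟩-++ (act* b G) f g) (K-trans (+-cong (K-sym (⟨⟩-actC G b f)) (K-sym (⟨⟩-actC G b g)))
    (K-sym (⟨⟩-++ G (actC b f) (actC b g))))))

  chainAction : ℕ → BAction B c ℓ
  chainAction q = record
    { group   = chainGroup q
    ; _▹_     = actC
    ; ▹-cong  = λ b {f} {g} f≈g → ≈C-by-cochains (λ {G} _ → K-trans (⟨⟩-actC G b f)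
        (K-trans (⟨⟩-cong-≈C (act*-supported b G) {f} {g} f≈g) (K-sym (⟨⟩-actC G b g))))
    ; ▹-+     = actC-hom-++
    ; ▹-assoc = λ a b f → ≈C-by-cochains (λ {G} sG → K-trans (⟨⟩-actC G (a · b) f)
        (K-trans (⟨⟩-cong (act*-assoc a b G sG) f) (K-sym (K-trans (⟨⟩-actC G a (actC b f)) (⟨⟩-actC (act* a G) b f)))))
    }

  module Ch {q} = BAction (chainAction q)

  actC-single : ∀ {q b} r {v : Vec (Fin n) (suc q)} → b ∈B≥ x → IsChain x v →
                actC b ((r , v) ∷ []) ≈C ((r , b ·ᵛ v) ∷ [])
  actC-single {b = b} r {v} b∈ c = ≈C-by-cochains (λ {G} _ →
    K-trans (⟨⟩-actC G b ((r , v) ∷ [])) (+-congʳ (*-congˡ (act*-∈ G b∈ c))))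

  single-¬chain : ∀ {q} r {v : Vec (Fin n) (suc q)} → ¬ IsChain x v → ((r , v) ∷ []) ≈C []
  single-¬chain r ¬c = ≈C-by-cochains (λ sG → K-trans (+-identityʳ _) (K-trans (*-congˡ (sG ¬c)) (zeroʳ r)))

  actC-∉ : ∀ {q b} → ¬ b ∈B≥ x → (f : Chains q) → actC b f ≈C []
  actC-∉ {b = b} b∉ f = ≈C-by-cochains (λ {G} _ → K-trans (⟨⟩-actC G b f) (⟨⟩-0 (λ v → act*-∉ G v b∉) f))

  -- A cochain on the empty tuple is a single scalar, and its coboundary is constant on vertices. So
  -- ε is the boundary in lowest degree, and the identities for `d` cover it too.
  d-const : ∀ (H : Cochain 0) f → ⟨ d H , f ⟩ ≈ ε f * H []
  d-const H f = K-trans (go f) (*-congʳ (reflexive (sym (ε≡ f))))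
    where
    one : ∀ r v → r * d H v ≈ augment (r , v) * H []
    one r (z ∷ []) with isChain? x (z ∷ [])
    ... | yes _ = K-refl
    ... | no _  = K-trans (zeroʳ r) (K-sym (zeroˡ (H [])))
    go : ∀ f → ⟨ d H , f ⟩ ≈ Σ𝕜 (List.map augment f) * H []
    go []            = K-sym (zeroˡ (H []))
    go ((r , v) ∷ f) = K-trans (+-cong (one r v) (go f)) (K-sym (distribʳ (H []) _ _))

  unit : Cochain 0
  unit _ = 1#

  supported₀ : (H : Cochain 0) → Supported H
  supported₀ H {[]} ¬c = contradiction ([] , []) ¬c

  ε≈⟨⟩ : ∀ f → ε f ≈ ⟨ d unit , f ⟩
  ε≈⟨⟩ f = K-sym (K-trans (d-const unit f) (*-identityʳ (ε f)))

  ε-isHom : IsKBHom R B (C 0) 𝕜X ε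
  ε-isHom = record
    { cong  = λ {f} {g} f≈g → K-trans (ε≈⟨⟩ f)
        (K-trans (⟨⟩-cong-≈C (d-supported unit) {f} {g} f≈g) (K-sym (ε≈⟨⟩ g)))
    ; hom-⊕ = λ f g → K-trans (ε≈⟨⟩ (f ++ g))
        (K-trans (⟨⟩-++ (d unit) f g) (K-sym (+-cong (ε≈⟨⟩ f) (ε≈⟨⟩ g))))
    ; hom-• = λ r f → K-trans (ε≈⟨⟩ (r • f)) (K-trans (⟨⟩-• (d unit) r f) (*-congˡ (K-sym (ε≈⟨⟩ f))))
    ; hom-▹ = λ b f → K-trans (ε≈⟨⟩ (actC b f)) (K-trans (⟨⟩-actC (d unit) b f)
        (K-trans (⟨⟩-cong (act*-d b unit (supported₀ unit)) f)
        (K-trans (d-const (act* b unit) f) (K-trans (go b (ε f)) (reflexive (sym (act𝕜X≡ b (ε f))))))))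
    }
    where
    go : ∀ b r → r * act* b unit [] ≈ actK b r
    go b r with b ∈B≥? x
    ... | yes _ = *-identityʳ r
    ... | no _  = zeroʳ r

  ∂-isHom : ∀ q → IsKBHom R B (C (suc q)) (C q) ∂
  ∂-isHom q = record
    { cong  = λ {f} {g} f≈g → ≈C-by-cochains (λ {G} _ → K-trans (⟨⟩-∂ G f)
        (K-trans (⟨⟩-cong-≈C (d-supported G) {f} {g} f≈g) (K-sym (⟨⟩-∂ G g))))
    ; hom-⊕ = λ f g → ≈C-by-cochains (λ {G} _ → K-trans (⟨⟩-∂ G (f ++ g)) (K-trans (⟨⟩-++ (d G) f g)
        (K-trans (+-cong (K-sym (⟨⟩-∂ G f)) (K-sym (⟨⟩-∂ G g))) (K-sym (⟨⟩-++ G (∂ f) (∂ g))))))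
    ; hom-• = λ r f → ≈C-by-cochains (λ {G} _ → K-trans (⟨⟩-∂ G (r • f)) (K-trans (⟨⟩-• (d G) r f)
        (K-trans (*-congˡ (K-sym (⟨⟩-∂ G f))) (K-sym (⟨⟩-• G r (∂ f))))))
    ; hom-▹ = λ b f → ≈C-by-cochains (λ {G} sG → K-trans (⟨⟩-∂ G (actC b f)) (K-trans (⟨⟩-actC (d G) b f)
        (K-trans (⟨⟩-cong (act*-d b G sG) f) (K-sym (K-trans (⟨⟩-actC G b (∂ f)) (⟨⟩-∂ (act* b G) f))))))
    }

  ∂∂≈[] : ∀ q (f : Chains (suc (suc q))) → ∂ (∂ f) ≈C []
  ∂∂≈[] q f = ≈C-by-cochains (λ {G} _ → K-trans (⟨⟩-∂ G (∂ f)) (K-trans (⟨⟩-∂ (d G) f) (⟨⟩-0 (dd≈0 G) f)))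

  ε∂≈0# : ∀ f → ε (∂ f) ≈ 0#
  ε∂≈0# f = K-trans (ε≈⟨⟩ (∂ f)) (K-trans (⟨⟩-∂ (d unit) f) (⟨⟩-0 (dd≈0 unit) f))

  ε-surjective : ∀ r → ∃[ f ] (ε f ≈ r)
  ε-surjective r = ((r , x ∷ []) ∷ []) , K-trans (reflexive (ε≡ ((r , x ∷ []) ∷ []))) (K-trans (+-identityʳ _) value)
    where
    value : augment (r , x ∷ []) ≈ r
    value with isChain? x (x ∷ [])
    ... | yes _ = K-refl
    ... | no ¬c = contradiction ((≤σ⇒∈B≥ ≤σ-refl ∷ []) , [-]) ¬c

  -- Each chain is the translate of itself by its top, so `P▹≈0` applies term by term.
  P≈[] : Connected → ∀ {q} (f : Chains q) → Projectors.P (chainAction q) f ≈C []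
  P≈[] connected {q} [] = Additive.ε-homo (Projectors.Π-additive (chainAction q) (allFin n))
  P≈[] connected {q} ((r , v) ∷ f) = begin
    P (((r , v) ∷ []) ++ f)        ≈⟨ Additive.∙-homo (Π-additive (allFin n)) ((r , v) ∷ []) f ⟩
    P ((r , v) ∷ []) ++ P f        ≈⟨ Ch.+-cong {q} {P ((r , v) ∷ [])} {[]} {P f} {[]}
                                        (one (isChain? x v)) (P≈[] connected f) ⟩
    []                             ∎
    where
    open Projectors (chainAction q)
    open SetoidReasoning (Ch.setoid {q})
    one : Dec (IsChain x v) → P ((r , v) ∷ []) ≈C []
    one (no ¬c) = begin
      P ((r , v) ∷ [])                   ≈⟨ Π-cong (allFin n) (single-¬chain r ¬c) ⟩
      P []                               ≈⟨ Additive.ε-homo (Π-additive (allFin n)) ⟩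
      []                                 ∎
    one (yes c) = begin
      P ((r , v) ∷ [])                   ≡⟨ cong (λ u → P ((r , u) ∷ [])) (top·ᵛ≡ c) ⟨
      P ((r , top v ·ᵛ v) ∷ [])          ≈⟨ Π-cong (allFin n) (actC-single r (top-∈B≥ c) c) ⟨
      P (actC (top v) ((r , v) ∷ []))    ≈⟨ P▹≈0 connected (top v) ((r , v) ∷ []) ⟩
      []                                 ∎

  Bounds : ∀ {q} → Chains q → Set (c ⊔ ℓ)
  Bounds f = ∃[ g ] (∂ g ≈C f)

  ∂-additive : ∀ q → Additive (chainGroup (suc q)) (chainGroup q) ∂
  ∂-additive q = record { ⟦⟧-cong = IsKBHom.cong (∂-isHom q) ; ∙-homo = IsKBHom.hom-⊕ (∂-isHom q) }

  module _ {q : ℕ} where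
    private
      module A = AbelianGroup (chainGroup q)
      module A⁻ = AbelianGroupProperties (chainGroup q)
      module S = Subtraction (chainGroup q)
      module ∂ = Additive (∂-additive q)
      module Alt = Alternating (chainGroup q) (Fin n)
    open Projectors (chainAction q)

    bounds-≈ : ∀ {f f′} → f ≈C f′ → Bounds f → Bounds f′
    bounds-≈ {f} {f′} f≈f′ (g , ∂g≈f) = g , A.trans {∂ g} {f} {f′} ∂g≈f f≈f′

    bounds-++ : ∀ {f f′} → Bounds f → Bounds f′ → Bounds (f ++ f′)
    bounds-++ {f} {f′} (g , p) (g′ , p′) = g ++ g′ ,
      A.trans {∂ (g ++ g′)} {∂ g ++ ∂ g′} {f ++ f′} (∂.∙-homo g g′) (A.∙-cong {∂ g} {f} {∂ g′} {f′} p p′)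

    bounds-negate : ∀ {f} → Bounds f → Bounds (negate f)
    bounds-negate {f} (g , p) = negate g ,
      A.trans {∂ (negate g)} {negate (∂ g)} {negate f} (∂.⁻¹-homo g) (A.⁻¹-cong {∂ g} {f} p)

    bounds-sign : ∀ k {f} → Bounds (Alt.sign k f) → Bounds f
    bounds-sign zero    bd = bd
    bounds-sign (suc k) {f} bd = bounds-sign k (bounds-≈ (A⁻.⁻¹-involutive (Alt.sign k f)) (bounds-negate bd))

    ⟨⟩-signC : ∀ k (G : Cochain (suc q)) f → ⟨ G , Alt.sign k f ⟩ ≈ sign k ⟨ G , f ⟩
    ⟨⟩-signC zero    G f = K-refl
    ⟨⟩-signC (suc k) G f = K-trans (⟨⟩-negate G (Alt.sign k f)) (-‿cong (⟨⟩-signC k G f))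

    -- Up to sign, the translate of a cycle by `b` is the boundary of its cone. Being a cycle is
    -- expressed through cochains so that ε f = 0 in degree zero and ∂ f = 0 above it are treated
    -- together.
    bounds-act : ∀ b f → (∀ {G : Cochain (suc q)} → Supported G → ⟨ d (cone* b G) , f ⟩ ≈ 0#) → Bounds (actC b f)
    bounds-act b f cyc = go (b ∈B≥? x)
      where
      open SetoidReasoning setoid
      go : Dec (b ∈B≥ x) → Bounds (actC b f)
      go (no b∉)  = bounds-≈ (A.sym {actC b f} {[]} (actC-∉ b∉ f)) ([] , ∂.ε-homo)
      -- The apex stands behind q + 1 entries, so the face that omits it carries q + 1 signs.
      go (yes b∈) = bounds-sign (suc q) (cone b f , ≈C-by-cochains λ {G} sG → begin
        ⟨ G , ∂ (cone b f) ⟩                      ≈⟨ ⟨⟩-∂ G (cone b f) ⟩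
        ⟨ d G , cone b f ⟩                        ≈⟨ ⟨⟩-cone (d G) b f ⟩
        ⟨ cone* b (d G) , f ⟩                     ≈⟨ ⟨⟩-cong (cone*-d b∈ G sG) f ⟩
        ⟨ (λ v → d (cone* b G) v + sign (suc q) (act* b G v)) , f ⟩
          ≈⟨ ⟨⟩-+ (d (cone* b G)) (λ v → sign (suc q) (act* b G v)) f ⟩
        ⟨ d (cone* b G) , f ⟩ + ⟨ (λ v → sign (suc q) (act* b G v)) , f ⟩
          ≈⟨ +-cong (cyc sG) (⟨⟩-sign (suc q) (act* b G) f) ⟩
        0# + sign (suc q) ⟨ act* b G , f ⟩        ≈⟨ +-identityˡ _ ⟩
        sign (suc q) ⟨ act* b G , f ⟩             ≈⟨ sign-cong (suc q) (⟨⟩-actC G b f) ⟨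
        sign (suc q) ⟨ G , actC b f ⟩             ≈⟨ ⟨⟩-signC (suc q) G (actC b f) ⟨
        ⟨ G , Alt.sign (suc q) (actC b f) ⟩       ∎)

    -- The cycles f and (1 - s) f differ by s f, which bounds. Passing through all factors of `P`
    -- reduces the claim to `P f`, which is zero.
    cycles-bound : Connected → ∀ {p} (Cycle : Chains q → Set p) →
                   (∀ b {f} → Cycle f → Cycle (f ++ negate (actC b f))) →
                   (∀ b {f} → Cycle f → Bounds (actC b f)) → ∀ {f} → Cycle f → Bounds f
    cycles-bound connected Cycle closed bd {f} f-cycle =
      go (allFin n) f-cycle (bounds-≈ (A.sym {P f} {[]} (P≈[] connected f)) ([] , ∂.ε-homo))
      where
      go : ∀ l {f} → Cycle f → Bounds (Π[1- l ] f) → Bounds f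
      go []      f-cycle bdΠ = bdΠ
      go (s ∷ l) {f} f-cycle bdΠ = bounds-≈ rearrange (bounds-++ (go l (closed s f-cycle) bdΠ) (bd s f-cycle))
        where
        rearrange : ((f ++ negate (actC s f)) ++ actC s f) ≈C f
        rearrange = A⁻.//-rightDividesˡ (actC s f) f

  exact-at-0 : Connected → ∀ (f : Chains 0) → ε f ≈ 0# → Bounds f
  exact-at-0 connected f = cycles-bound connected (λ f → ε f ≈ 0#) closed bd
    where
    module E = IsKBHom ε-isHom
    ε-additive : Additive (chainGroup 0) +-abelianGroup ε
    ε-additive = record { ⟦⟧-cong = E.cong ; ∙-homo = E.hom-⊕ }
    actK-0 : ∀ b {r} → r ≈ 0# → actK b r ≈ 0#
    actK-0 b r≈0 with b ∈B≥? x
    ... | yes _ = r≈0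
    ... | no _  = K-refl
    closed : ∀ b {f} → ε f ≈ 0# → ε (f ++ negate (actC b f)) ≈ 0#
    closed b {f} εf≈0 = K-trans (Additive.minus-homo ε-additive f (actC b f)) (K-trans
      (+-cong εf≈0 (-‿cong (K-trans (E.hom-▹ b f) (K-trans (reflexive (act𝕜X≡ b (ε f))) (actK-0 b εf≈0)))))
      (K-trans (+-identityˡ _) ε⁻¹≈ε))
    bd : ∀ b {f} → ε f ≈ 0# → Bounds (actC b f)
    -- In degree zero `cone* b G` is a scalar at the empty tuple, so the pairing is a multiple of ε
    -- f.
    bd b {f} εf≈0 = bounds-act b f (λ {G} _ → K-trans (d-const (cone* b G) f) (K-trans (*-congʳ εf≈0) (zeroˡ _)))

  exact-at-suc : Connected → ∀ q (f : Chains (suc q)) → ∂ f ≈C [] → Bounds f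
  exact-at-suc connected q f = cycles-bound connected (λ f → ∂ f ≈C []) closed bd
    where
    module E = IsKBHom (∂-isHom q)
    module A = AbelianGroup (chainGroup q)
    open SetoidReasoning A.setoid
    closed : ∀ b {f} → ∂ f ≈C [] → ∂ (f ++ negate (actC b f)) ≈C []
    closed b {f} ∂f≈0 = begin
      ∂ (f ++ negate (actC b f))     ≈⟨ Additive.minus-homo (∂-additive q) f (actC b f) ⟩
      ∂ f A.- ∂ (actC b f)           ≈⟨ S.-‿cong₂ {∂ f} {[]} {∂ (actC b f)} {[]} ∂f≈0 (begin
        ∂ (actC b f)   ≈⟨ E.hom-▹ b f ⟩
        actC b (∂ f)   ≈⟨ BAction.▹-cong (chainAction q) b {∂ f} {[]} ∂f≈0 ⟩
        actC b []      ≈⟨ Projectors.▹-0 (chainAction q) b ⟩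
        []             ∎) ⟩
      [] A.- []                      ≈⟨ S.x-0≈x [] ⟩
      []                             ∎
      where module S = Subtraction (chainGroup q)
    bd : ∀ b {f} → ∂ f ≈C [] → Bounds (actC b f)
    bd b {f} ∂f≈0 = bounds-act b f (λ {G} _ → K-trans (K-sym (⟨⟩-∂ (cone* b G) f))
      (⟨⟩-cong-≈C (cone*-supported b G) {∂ f} {[]} ∂f≈0))

-- Rank and canonical representatives of σ-classes.

module σClasses (B : LRB) where
  open LRBNotions B
  open LRBOrder B

  downset : Fin n → Subset.Subset n
  downset y = Vec.tabulate (λ c → does (c ≤σ? y))

  ∈-downset⁺ : ∀ {c y} → c ≤σ y → c Subset.∈ downset y
  ∈-downset⁺ {c} {y} c≤y = Vec.lookup⇒[]= c _ (trans (Vec.lookup∘tabulate _ c) (dec-true (c ≤σ? y) c≤y))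

  ∈-downset⁻ : ∀ {c y} → c Subset.∈ downset y → c ≤σ y
  ∈-downset⁻ {c} {y} c∈ = go (c ≤σ? y) (trans (sym (Vec.lookup∘tabulate _ c)) (Vec.[]=⇒lookup c∈))
    where
    go : (c≤?y : Dec (c ≤σ y)) → does c≤?y ≡ true → c ≤σ y
    go (yes c≤y) _ = c≤y

  -- It depends only on the σ-class and grows strictly with it, which allows lifts to be built one
  -- natural number at a time.
  rank : Fin n → ℕ
  rank y = Subset.∣ downset y ∣

  rank-mono : ∀ {y z} → y ≤σ z → rank y ≤ rank z
  rank-mono y≤z = Subset.p⊆q⇒∣p∣≤∣q∣ (λ c∈ → ∈-downset⁺ (≤σ-trans (∈-downset⁻ c∈) y≤z))

  rank-strict : ∀ {y z} → y <σ z → rank y < rank z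
  rank-strict (y≤z , z≰y) = Subset.p⊂q⇒∣p∣<∣q∣
    ((λ c∈ → ∈-downset⁺ (≤σ-trans (∈-downset⁻ c∈) y≤z)) , _ , ∈-downset⁺ ≤σ-refl , λ z∈ → z≰y (∈-downset⁻ z∈))

  infix 4 _~σ_
  _~σ_ : Fin n → Fin n → Set
  y ~σ z = y ≤σ z × z ≤σ y

  ~σ-refl : ∀ {y} → y ~σ y
  ~σ-refl = ≤σ-refl , ≤σ-refl

  ~σ-trans : ∀ {y z w} → y ~σ z → z ~σ w → y ~σ w
  ~σ-trans (a , b) (c , d) = ≤σ-trans a c , ≤σ-trans d b

  ~σ-sym : ∀ {y z} → y ~σ z → z ~σ y
  ~σ-sym (a , b) = b , a

  _~σ?_ : ∀ y z → Dec (y ~σ z)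
  y ~σ? z = (y ≤σ? z) ×-dec (z ≤σ? y)

  firstIn : List (Fin n) → Fin n → Fin n
  -- A default value: in `allFin n` the search stops at `y` at the latest.
  firstIn []      y = y
  firstIn (z ∷ l) y with y ~σ? z
  ... | yes _ = z
  ... | no _  = firstIn l y

  firstIn-~ : ∀ l y → y ~σ firstIn l y
  firstIn-~ []      y = ~σ-refl
  firstIn-~ (z ∷ l) y with y ~σ? z
  ... | yes y~z = y~z
  ... | no _    = firstIn-~ l y

  firstIn-cong : ∀ {l y y′} → y ∈ l → y ~σ y′ → firstIn l y ≡ firstIn l y′
  firstIn-cong {z ∷ l} {y} {y′} y∈ y~y′ with y ~σ? z | y′ ~σ? z
  ... | yes _   | yes _    = refl
  ... | yes y~z | no ¬y′~z = contradiction (~σ-trans (~σ-sym y~y′) y~z) ¬y′~z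
  ... | no ¬y~z | yes y′~z = contradiction (~σ-trans y~y′ y′~z) ¬y~z
  ... | no ¬y~z | no _     = firstIn-cong (tail y∈) y~y′
    where
    tail : y ∈ z ∷ l → y ∈ l
    tail (here refl) = contradiction ~σ-refl ¬y~z
    tail (there y∈l) = y∈l

  canon : Fin n → Fin n
  canon = firstIn (allFin n)

  ~canon : ∀ y → y ~σ canon y
  ~canon = firstIn-~ (allFin n)

  canon-cong : ∀ {y y′} → y ~σ y′ → canon y ≡ canon y′
  canon-cong {y} = firstIn-cong (∈-allFin y)

-- Equivariant maps, and projectivity of the chain modules.

kbAction : ∀ {c ℓ m ℓm} {R : CommutativeRing c ℓ} {B : LRB} → KBModule R B m ℓm → BAction B m ℓm
kbAction M = record
  { group   = Module.+ᴹ-abelianGroup module𝕜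
  ; _▹_     = _▹_
  ; ▹-cong  = ▹-cong
  ; ▹-+     = ▹-+
  ; ▹-assoc = ▹-assoc
  }
  where open KBModule M

module Equivariant {B : LRB} {a ℓ a′ ℓ′} (M : BAction B a ℓ) (N : BAction B a′ ℓ′) where
  private
    module M = BAction M
    module N = BAction N
    module PM = Projectors M
    module PN = Projectors N
    module SN = Subtraction N.group

  Π-commutes : ∀ {h} → Additive M.group N.group h → (∀ b m → h (b M.▹ m) N.≈ b N.▹ h m) →
               ∀ l m → h (PM.Π[1- l ] m) N.≈ PN.Π[1- l ] (h m)
  Π-commutes h-additive h-▹ []      m = N.≈-refl
  Π-commutes h-additive h-▹ (s ∷ l) m = N.≈-trans (Π-commutes h-additive h-▹ l (m M.- s M.▹ m))
    (PN.Π-cong l (N.≈-trans (Additive.minus-homo h-additive m (s M.▹ m)) (SN.-‿cong₂ N.≈-refl (h-▹ s m))))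

module Lifting {c ℓ m ℓm : Level} (R : CommutativeRing c ℓ) (B : LRB) (x : Fin (LRB.n B)) (q : ℕ)
               (M N : KBModule R B m ℓm)
               (π : Module.Carrierᴹ (KBModule.module𝕜 N) → Module.Carrierᴹ (KBModule.module𝕜 M))
               (π-hom : IsKBHom R B (KBModule.raw N) (KBModule.raw M) π)
               (π-surj : ∀ y → ∃[ z ] (Module._≈ᴹ_ (KBModule.module𝕜 M) (π z) y))
               (f : ChainComplex.Chains R B x q → Module.Carrierᴹ (KBModule.module𝕜 M))
               (f-hom : IsKBHom R B (ChainComplex.C R B x q) (KBModule.raw M) f) where
  open CommutativeRing R using (1#; +-congʳ; *-congʳ; *-identityʳ)
    renaming (Carrier to K; refl to K-refl; sym to K-sym; reflexive to K-reflexive)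
  open LRBNotions B hiding (assoc)
  open LRBOrder B
  open σClasses B
  open Tuples B x
  open ChainComplex R B x
  open Unfolding R B x using (actOne; actC≡)
  open Exactness R B x using (chainAction; actC-single; single-¬chain; negate; ≈C-by-cochains; _•_)

  private
    module M𝕜 = Module (KBModule.module𝕜 M)
    module N𝕜 = Module (KBModule.module𝕜 N)
    module π = IsKBHom π-hom
    module f = IsKBHom f-hom
    module MA = BAction (kbAction M)
    module NA = BAction (kbAction N)
    module CA = BAction (chainAction q)
    module MS = Subtraction MA.group
    module NS = Subtraction NA.group
    module CS = Subtraction CA.group
    module MΠ = Projectors (kbAction M)
    module NΠ = Projectors (kbAction N)
    module CΠ = Projectors (chainAction q)
    module NM = Equivariant (kbAction N) (kbAction M)
    module CM = Equivariant (chainAction q) (kbAction M)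
    module ⟨M⟩ = Pairing R B x (KBModule.module𝕜 M)
  open Pairing R B x (KBModule.module𝕜 N)

  π-additive : Additive NA.group MA.group π
  π-additive = record { ⟦⟧-cong = π.cong ; ∙-homo = π.hom-⊕ }

  f-additive : Additive CA.group MA.group f
  f-additive = record { ⟦⟧-cong = f.cong ; ∙-homo = f.hom-⊕ }

  single : Vec (Fin n) (suc q) → Chains q
  single v = (1# , v) ∷ []

  f̂ : ⟨M⟩.Cochain (suc q)
  f̂ v = f (single v)

  f̂-supported : ⟨M⟩.Supported f̂
  f̂-supported {v} ¬c = MA.≈-trans (f.cong {single v} {[]} (single-¬chain 1# ¬c)) (Additive.ε-homo f-additive)

  f≈⟨f̂⟩ : ∀ h → f h MA.≈ ⟨M⟩.⟨ f̂ , h ⟩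
  f≈⟨f̂⟩ []            = Additive.ε-homo f-additive
  f≈⟨f̂⟩ ((r , v) ∷ h) = MA.≈-trans (f.hom-⊕ ((r , v) ∷ []) h)
    (MA.+-cong (MA.≈-trans (f.cong {(r , v) ∷ []} {r • single v} r≈r1) (f.hom-• r (single v))) (f≈⟨f̂⟩ h))
    where
    r≈r1 : ((r , v) ∷ []) ≈C (r • single v)
    r≈r1 = ≈C-by-cochains (λ _ → +-congʳ (*-congʳ (K-sym (*-identityʳ r))))

  π⟨⟩ : (g : Cochain (suc q)) → ∀ h → π ⟨ g , h ⟩ MA.≈ ⟨M⟩.⟨ π ∘ g , h ⟩
  π⟨⟩ g []            = Additive.ε-homo π-additive
  π⟨⟩ g ((r , v) ∷ h) = MA.≈-trans (π.hom-⊕ (r N𝕜.*ₗ g v) ⟨ g , h ⟩) (MA.+-cong (π.hom-• r (g v)) (π⟨⟩ g h))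

  ▹⟨⟩ : ∀ b (g : Cochain (suc q)) h → b NA.▹ ⟨ g , h ⟩ NA.≈ ⟨ (λ v → b NA.▹ g v) , h ⟩
  ▹⟨⟩ b g []            = NΠ.▹-0 b
  ▹⟨⟩ b g ((r , v) ∷ h) = NA.≈-trans (NA.▹-+ b (r N𝕜.*ₗ g v) ⟨ g , h ⟩)
    (NA.+-cong (KBModule.▹-*ₗ N b r (g v)) (▹⟨⟩ b g h))

  ⟨⟩-additive : (g : Cochain (suc q)) → Supported g → Additive CA.group NA.group ⟨ g ,_⟩
  ⟨⟩-additive g sg = record { ⟦⟧-cong = λ {h} {h′} → ⟨⟩-cong-≈C sg {h} {h′} ; ∙-homo = ⟨⟩-++ g }

  -- Both conditions on the map `⟨ g ,_⟩`, tested on one tuple. Through `act*` the second one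
  -- includes the translates of `v` that are zero.
  record LiftsAt (g : Cochain (suc q)) (v : Vec (Fin n) (suc q)) : Set (c ⊔ m ⊔ ℓm) where
    field
      π-lifts : π (g v) MA.≈ f̂ v
      equivar : ∀ b → act* b g v NA.≈ b NA.▹ g v

  RankBelow : ℕ → Vec (Fin n) (suc q) → Set
  RankBelow k v = rank (top v) < k

  LiftsBelow : ℕ → Cochain (suc q) → Set (c ⊔ m ⊔ ℓm)
  LiftsBelow k g = ∀ {v} → IsChain x v → RankBelow k v → LiftsAt g v

  -- The tuples of `e` may fail to be chains; supported cochains vanish on those.
  Low : ℕ → Chains q → Set (c ⊔ ℓ)
  Low k h = ∃[ e ] (ListAll.All (RankBelow k ∘ proj₂) e × h ≈C e)

  low-≈ : ∀ {k h h′} → h ≈C h′ → Low k h → Low k h′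
  low-≈ {k} {h} {h′} h≈h′ (e , low , h≈e) = e , low , CA.≈-trans {h′} {h} {e} (CA.≈-sym {h} {h′} h≈h′) h≈e

  low-++ : ∀ {k h h′} → Low k h → Low k h′ → Low k (h ++ h′)
  low-++ {k} {h} {h′} (e , low , h≈e) (e′ , low′ , h′≈e′) =
    e ++ e′ , ListAll.++⁺ low low′ , CA.+-cong {h} {e} {h′} {e′} h≈e h′≈e′

  low-negate : ∀ {k h} → Low k h → Low k (negate h)
  low-negate {k} {h} (e , low , h≈e) = negate e , ListAll.map⁺ low , CA.-‿cong {h} {e} h≈e

  low-actC : ∀ {k} b h → rank b < k → Low k (actC b h)
  low-actC {k} b h b<k =
    concatMap (actOne b) h , go h , λ s → K-reflexive (cong (λ h → coeff h s) (actC≡ b h))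
    where
    one : ∀ p → ListAll.All (RankBelow k ∘ proj₂) (actOne b p)
    one (r , v) with b ∈B≥? x | isChain? x v
    ... | yes _ | yes _ =
      subst (λ z → rank z < k) (sym (top-map (b ·_) v)) (ℕ.≤-<-trans (rank-mono ≤σ-·ˡ) b<k) ∷ []
    ... | yes _ | no _  = []
    ... | no _  | _     = []
    go : ∀ h → ListAll.All (RankBelow k ∘ proj₂) (concatMap (actOne b) h)
    go []      = []
    go (p ∷ h) = ListAll.++⁺ (one p) (go h)

  -- Each factor 1 - s contributes a translate by `a · s`, and the tops of its tuples lie below
  -- `a · s`; the contributions telescope.
  low-Π : ∀ {k} a l h → (∀ {s} → s ∈ l → rank (a · s) < k) → Low k (actC a (CΠ.Π[1- l ] h) CA.- actC a h)
  low-Π a []      h l<k = [] , [] , CS.x-x≈0 {actC a h} {actC a h} (CA.≈-refl {actC a h})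
  low-Π {k} a (s ∷ l) h l<k = low-≈ (begin
    (aΠh′ CA.- ah′) ++ negate ash         ≈⟨ CA.+-congˡ {aΠh′ CA.- ah′} {negate ash} {ah′ CA.- ah} tail ⟩
    (aΠh′ CA.- ah′) ++ (ah′ CA.- ah)      ≈⟨ telescope aΠh′ ah′ ah ⟩
    aΠh′ CA.- ah                          ∎)
    (low-++ (low-Π a l h′ (l<k ∘ there)) (low-negate (low-actC (a · s) h (l<k (here refl)))))
    where
    open SetoidReasoning CA.setoid
    open AbelianGroupProperties CA.group using (xyx⁻¹≈y; //-rightDividesˡ)
    h′   = h CA.- actC s h
    ah   = actC a h
    ah′  = actC a h′
    ash  = actC (a · s) h
    aΠh′ = actC a (CΠ.Π[1- l ] h′)
    telescope : ∀ f g h → ((f CA.- g) ++ (g CA.- h)) ≈C (f CA.- h)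
    telescope f g h = begin
      (f CA.- g) ++ (g CA.- h)      ≈⟨ CA.+-assoc (f CA.- g) g (negate h) ⟨
      ((f CA.- g) ++ g) CA.- h      ≈⟨ CA.+-congʳ {negate h} {(f CA.- g) ++ g} {f} (//-rightDividesˡ g f) ⟩
      f CA.- h                      ∎
    tail : negate ash ≈C (ah′ CA.- ah)
    tail = begin
      negate ash                  ≈⟨ xyx⁻¹≈y ah (negate ash) ⟨
      (ah CA.- ash) CA.- ah       ≈⟨ CA.+-congʳ {negate ah} {ah′} {ah CA.- ash} (CΠ.▹-[1-s] a s h) ⟨
      ah′ CA.- ah                 ∎

  module _ {k} (g : Cochain (suc q)) (sg : Supported g) (lifts : LiftsBelow k g) where

    module ⟨g⟩ = Additive (⟨⟩-additive g sg)

    low-lifts : ∀ {h} → Low k h → π ⟨ g , h ⟩ MA.≈ f h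
    low-lifts {h} (e , low , h≈e) = begin
      π ⟨ g , h ⟩        ≈⟨ π.cong (⟨g⟩.⟦⟧-cong {h} {e} h≈e) ⟩
      π ⟨ g , e ⟩        ≈⟨ π⟨⟩ g e ⟩
      ⟨M⟩.⟨ π ∘ g , e ⟩  ≈⟨ ⟨M⟩.⟨⟩-cong-All (ListAll.map (λ {(_ , v)} v<k → at v v<k (isChain? x v)) low) ⟩
      ⟨M⟩.⟨ f̂ , e ⟩      ≈⟨ f≈⟨f̂⟩ e ⟨
      f e                ≈⟨ f.cong {h} {e} h≈e ⟨
      f h                ∎
      where
      open SetoidReasoning MA.setoid
      at : ∀ v → RankBelow k v → Dec (IsChain x v) → π (g v) MA.≈ f̂ v
      at v v<k (yes c) = LiftsAt.π-lifts (lifts c v<k)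
      at v v<k (no ¬c) = MA.≈-trans (π.cong (sg ¬c))
        (MA.≈-trans (Additive.ε-homo π-additive) (MA.≈-sym (f̂-supported ¬c)))

    low-equivar : ∀ {h} → Low k h → ∀ b → ⟨ g , actC b h ⟩ NA.≈ b NA.▹ ⟨ g , h ⟩
    low-equivar {h} (e , low , h≈e) b = begin
      ⟨ g , actC b h ⟩              ≈⟨ ⟨g⟩.⟦⟧-cong {actC b h} {actC b e} (CA.▹-cong b {h} {e} h≈e) ⟩
      ⟨ g , actC b e ⟩              ≈⟨ ⟨⟩-actC g b e ⟩
      ⟨ act* b g , e ⟩              ≈⟨ ⟨⟩-cong-All (ListAll.map (λ {(_ , v)} v<k → at v v<k (isChain? x v)) low) ⟩
      ⟨ (λ v → b NA.▹ g v) , e ⟩    ≈⟨ ▹⟨⟩ b g e ⟨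
      b NA.▹ ⟨ g , e ⟩              ≈⟨ NA.▹-cong b (⟨g⟩.⟦⟧-cong {h} {e} h≈e) ⟨
      b NA.▹ ⟨ g , h ⟩              ∎
      where
      open SetoidReasoning NA.setoid
      at : ∀ v → RankBelow k v → Dec (IsChain x v) → act* b g v NA.≈ b NA.▹ g v
      at v v<k (yes c) = LiftsAt.equivar (lifts c v<k) b
      at v v<k (no ¬c) = NA.≈-trans (act*-supported b g ¬c) (NA.≈-sym (NA.≈-trans (NA.▹-cong b (sg ¬c)) (NΠ.▹-0 b)))

    -- The terms of y Q r other than v. The arguments are separate because along an orbit `y` and
    -- `v` vary, while the representatives `z` and `r` stay fixed.
    correction : Fin n → Fin n → Vec (Fin n) (suc q) → Vec (Fin n) (suc q) → Chains q
    correction y z r v = actC y (CΠ.Π[1- CΠ.NotAbove z ] (single r)) CA.- single v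

    candidate : Fin n → Fin n → Vec (Fin n) (suc q) → Vec (Fin n) (suc q) → NA.Carrier
    candidate y z r v = y NA.▹ NΠ.Π[1- NΠ.NotAbove z ] (proj₁ (π-surj (f̂ r))) NA.- ⟨ g , correction y z r v ⟩

    -- With z the canonical element of the class of `top v`, any `b` above that class satisfies z b
    -- = z, so `v` and `b ·ᵛ v` have the same representative. The lifts at both then start from the
    -- same preimage.
    rep : Vec (Fin n) (suc q) → Vec (Fin n) (suc q)
    rep v = canon (top v) ·ᵛ v

    extended : Cochain (suc q)
    extended v = candidate (top v) (canon (top v)) (rep v) v

    choose : ∀ v → Dec (RankBelow k v) → NA.Carrier
    choose v (yes _) = g v
    choose v (no _)  = extended v

    g⁺ : Cochain (suc q)
    g⁺ = restrict (λ v → choose v (rank (top v) ℕ.<? k))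

    g⁺-supported : Supported g⁺
    g⁺-supported = restrict-¬chain _

    g⁺-low : ∀ {v} → IsChain x v → RankBelow k v → g⁺ v NA.≈ g v
    g⁺-low {v} c v<k = NA.≈-trans (restrict-chain _ c) (go (rank (top v) ℕ.<? k))
      where
      go : ∀ d → choose v d NA.≈ g v
      go (yes _)  = NA.≈-refl
      go (no v≮k) = contradiction v<k v≮k

    g⁺-high : ∀ {v} → IsChain x v → ¬ RankBelow k v → g⁺ v NA.≈ extended v
    g⁺-high {v} c v≮k = NA.≈-trans (restrict-chain _ c) (go (rank (top v) ℕ.<? k))
      where
      go : ∀ d → choose v d NA.≈ extended v
      go (yes v<k) = contradiction v<k v≮k
      go (no _)    = NA.≈-refl

    act*-g⁺-low : ∀ {b v} → IsChain x v → (IsChain x (b ·ᵛ v) → rank (b · top v) < k) → act* b g⁺ v NA.≈ act* b g v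
    act*-g⁺-low {b} {v} c low = go (b ∈B≥? x) (isChain? x (b ·ᵛ v))
      where
      go : Dec (b ∈B≥ x) → Dec (IsChain x (b ·ᵛ v)) → act* b g⁺ v NA.≈ act* b g v
      go (no b∉)  _        = NA.≈-trans (act*-∉ g⁺ v b∉) (NA.≈-sym (act*-∉ g v b∉))
      go (yes b∈) (yes bc) = NA.≈-trans (act*-∈ g⁺ b∈ c)
        (NA.≈-trans (g⁺-low bc (subst (λ z → rank z < k) (sym (top-map (b ·_) v)) (low bc))) (NA.≈-sym (act*-∈ g b∈ c)))
      go (yes b∈) (no ¬bc) = NA.≈-trans (act*-∈ g⁺ b∈ c)
        (NA.≈-trans (g⁺-supported ¬bc) (NA.≈-sym (NA.≈-trans (act*-∈ g b∈ c) (sg ¬bc))))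

    module _ {v} (v-chain : IsChain x v) (v≮k : ¬ RankBelow k v) (v≤k : rank (top v) ≤ k) where

      private
        y = top v
        z = canon y
        r = rep v
        Qr = CΠ.Π[1- CΠ.NotAbove z ] (single r)
        n₀ = proj₁ (π-surj (f̂ r))
        Qn = NΠ.Π[1- NΠ.NotAbove z ] n₀
        w = correction y z r v
        y≤z : y ≤σ z
        y≤z = proj₁ (~canon y)
        z≤y : z ≤σ y
        z≤y = proj₂ (~canon y)
        y∈ : y ∈B≥ x
        y∈ = top-∈B≥ v-chain

      y▹single : actC y (single r) ≈C single v
      y▹single = subst (λ u → actC y (single r) ≈C single u) (top-·ᵛ-fixes v-chain y≤z)
        (actC-single 1# y∈ (chain-·ᵛ v-chain y≤z))

      below-y : ∀ {b} → ¬ y ≤σ b → rank (y · b) < k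
      below-y y≰b = ℕ.<-≤-trans (rank-strict (≤σ-·ˡ , λ y≤yb → y≰b (≤σ-trans y≤yb ≤σ-·ʳ))) v≤k

      -- As y r = v, the correction is y Q r - y r, and an `s` not above `z` makes `y · s` strictly
      -- smaller than `y`.
      w-low : Low k w
      w-low = low-≈ (CS.-‿cong₂ {actC y Qr} {actC y Qr} {actC y (single r)} {single v} (CA.≈-refl {actC y Qr}) y▹single)
        (low-Π y (CΠ.NotAbove z) (single r) (λ s∈ → below-y (λ y≤s → CΠ.∈-NotAbove s∈ (≤σ-trans z≤y y≤s))))

      -- Equivariance moves π and f past y Q, so both terms become values of `f`: the result is f (y
      -- Q r - w), and y Q r - w = v.
      extended-lifts : π (extended v) MA.≈ f̂ v
      extended-lifts = begin
        π (y NA.▹ Qn NA.- ⟨ g , w ⟩)            ≈⟨ (Additive.minus-homo π-additive (y NA.▹ Qn) ⟨ g , w ⟩) ⟩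
        π (y NA.▹ Qn) MA.- π ⟨ g , w ⟩          ≈⟨ MS.-‿cong₂ (π.hom-▹ y Qn) (low-lifts w-low) ⟩
        y MA.▹ π Qn MA.- f w
          ≈⟨ MS.-‿cong₂ (MA.▹-cong y (NM.Π-commutes π-additive π.hom-▹ (NΠ.NotAbove z) n₀)) MA.≈-refl ⟩
        y MA.▹ MΠ.Π[1- NΠ.NotAbove z ] (π n₀) MA.- f w
          ≈⟨ MS.-‿cong₂ (MA.▹-cong y (MΠ.Π-cong (NΠ.NotAbove z) (proj₂ (π-surj (f̂ r))))) MA.≈-refl ⟩
        y MA.▹ MΠ.Π[1- NΠ.NotAbove z ] (f̂ r) MA.- f w
          ≈⟨ MS.-‿cong₂ (MA.▹-cong y (CM.Π-commutes f-additive f.hom-▹ (NΠ.NotAbove z) (single r))) MA.≈-refl ⟨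
        y MA.▹ f Qr MA.- f w                    ≈⟨ MS.-‿cong₂ (f.hom-▹ y Qr) MA.≈-refl ⟨
        f (actC y Qr) MA.- f w                  ≈⟨ Additive.minus-homo f-additive (actC y Qr) w ⟨
        f (actC y Qr CA.- w)
          ≈⟨ f.cong {actC y Qr CA.- w} {single v} (CS.x-[x-y]≈y (actC y Qr) (single v)) ⟩
        f̂ v                                     ∎
        where open SetoidReasoning MA.setoid

      -- The top of `b ·ᵛ v` is in the class of `y`, so its lift uses the same `z`, `r` and
      -- preimage, and its correction is the translate of `w` by `b`.
      extended-equivar-≥ : ∀ b → y ≤σ b → act* b g⁺ v NA.≈ b NA.▹ extended v
      extended-equivar-≥ b y≤b = begin
        act* b g⁺ v                             ≈⟨ act*-∈ g⁺ b∈ v-chain ⟩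
        g⁺ (b ·ᵛ v)                             ≈⟨ g⁺-high (chain-·ᵛ v-chain y≤b) bv≮k ⟩
        extended (b ·ᵛ v)                       ≡⟨ unfold ⟩
        candidate (b · y) z r (b ·ᵛ v)          ≡⟨⟩
        (b · y) NA.▹ Qn NA.- ⟨ g , correction (b · y) z r (b ·ᵛ v) ⟩
          ≈⟨ NS.-‿cong₂ (NA.▹-assoc b y Qn) (⟨g⟩.⟦⟧-cong {correction (b · y) z r (b ·ᵛ v)} {actC b w} corrections) ⟩
        b NA.▹ y NA.▹ Qn NA.- ⟨ g , actC b w ⟩  ≈⟨ NS.-‿cong₂ NA.≈-refl (low-equivar w-low b) ⟩
        b NA.▹ y NA.▹ Qn NA.- b NA.▹ ⟨ g , w ⟩  ≈⟨ (NΠ.▹-minus b (y NA.▹ Qn) ⟨ g , w ⟩) ⟨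
        b NA.▹ extended v                       ∎
        where
        open SetoidReasoning NA.setoid
        b∈ : b ∈B≥ x
        b∈ = ≤σ⇒∈B≥ (≤σ-trans (∈B≥⇒≤σ y∈) y≤b)
        by~y : y ~σ b · y
        by~y = ≤σ-glb y≤b ≤σ-refl , ≤σ-·ʳ
        bv≮k : ¬ RankBelow k (b ·ᵛ v)
        bv≮k bv<k = v≮k (ℕ.≤-<-trans (rank-mono (proj₁ by~y)) (subst (λ u → rank u < k) (top-map (b ·_) v) bv<k))
        rep≡ : z ·ᵛ b ·ᵛ v ≡ r
        rep≡ = trans (sym (·ᵛ-assoc z b v)) (cong (_·ᵛ v) (≤σ-trans z≤y y≤b))
        canon≡ : canon (b · y) ≡ z
        canon≡ = sym (canon-cong by~y)
        unfold : extended (b ·ᵛ v) ≡ candidate (b · y) z r (b ·ᵛ v)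
        unfold rewrite top-map (b ·_) v | canon≡ | rep≡ = refl
        corrections : correction (b · y) z r (b ·ᵛ v) ≈C actC b w
        corrections = C.begin
          actC (b · y) Qr CA.- single (b ·ᵛ v)            C.≈⟨ CS.-‿cong₂
            {actC (b · y) Qr} {actC b (actC y Qr)} {single (b ·ᵛ v)} {actC b (single v)} (CA.▹-assoc b y Qr)
            (CA.≈-sym {actC b (single v)} {single (b ·ᵛ v)} (actC-single 1# b∈ v-chain)) ⟩
          actC b (actC y Qr) CA.- actC b (single v)       C.≈⟨ CΠ.▹-minus b (actC y Qr) (single v) ⟨
          actC b w                                        C.∎
          where module C = SetoidReasoning CA.setoid

      -- Now `b · y` is not above `z`, so it kills Q in both modules. Hence b w = - b v, and b
      -- applied to the new value is g (b v), already fixed at a smaller rank.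
      extended-equivar-≱ : ∀ b → ¬ y ≤σ b → act* b g⁺ v NA.≈ b NA.▹ extended v
      extended-equivar-≱ b y≰b = begin
        act* b g⁺ v                             ≈⟨ act*-g⁺-low v-chain (λ _ → by<k) ⟩
        act* b g v                              ≈⟨ ⟨⟩-single (act* b g) v ⟨
        ⟨ act* b g , single v ⟩                 ≈⟨ ⟨⟩-actC g b (single v) ⟨
        ⟨ g , actC b (single v) ⟩               ≈⟨ NS.x-[x-y]≈y NA.0# _ ⟨
        NA.0# NA.- (NA.0# NA.- ⟨ g , actC b (single v) ⟩)
          ≈⟨ NS.-‿cong₂ (NA.≈-trans (NA.≈-sym (NA.▹-assoc b y Qn)) (NΠ.▹-Π-NotAbove n₀ z≰by)) on-w ⟨
        b NA.▹ y NA.▹ Qn NA.- b NA.▹ ⟨ g , w ⟩  ≈⟨ (NΠ.▹-minus b (y NA.▹ Qn) ⟨ g , w ⟩) ⟨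
        b NA.▹ extended v                       ∎
        where
        open SetoidReasoning NA.setoid
        ⟨⟩-single : (G : Cochain (suc q)) → ∀ v → ⟨ G , single v ⟩ NA.≈ G v
        ⟨⟩-single G v = NA.≈-trans (NA.+-identityʳ _) (N𝕜.*ₗ-identityˡ (G v))
        y≰by : ¬ y ≤σ b · y
        y≰by y≤by = y≰b (≤σ-trans y≤by ≤σ-·ˡ)
        z≰by : ¬ z ≤σ b · y
        z≰by z≤by = y≰by (≤σ-trans y≤z z≤by)
        by<k : rank (b · y) < k
        by<k = ℕ.<-≤-trans (rank-strict (≤σ-·ʳ , y≰by)) v≤k
        by▹Qr : actC b (actC y Qr) ≈C []
        by▹Qr = CA.≈-trans {actC b (actC y Qr)} {actC (b · y) Qr} {[]}
          (CA.≈-sym {actC (b · y) Qr} {actC b (actC y Qr)} (CA.▹-assoc b y Qr))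
          (CΠ.▹-Π-NotAbove (single r) z≰by)
        on-w : b NA.▹ ⟨ g , w ⟩ NA.≈ NA.0# NA.- ⟨ g , actC b (single v) ⟩
        on-w = begin
          b NA.▹ ⟨ g , w ⟩                                        ≈⟨ low-equivar w-low b ⟨
          ⟨ g , actC b w ⟩                                        ≈⟨ ⟨g⟩.⟦⟧-cong {actC b w} split ⟩
          ⟨ g , actC b (actC y Qr) CA.- actC b (single v) ⟩
            ≈⟨ ⟨g⟩.minus-homo (actC b (actC y Qr)) (actC b (single v)) ⟩
          ⟨ g , actC b (actC y Qr) ⟩ NA.- ⟨ g , actC b (single v) ⟩
            ≈⟨ NS.-‿cong₂ (⟨g⟩.⟦⟧-cong {actC b (actC y Qr)} {[]} by▹Qr) NA.≈-refl ⟩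
          NA.0# NA.- ⟨ g , actC b (single v) ⟩                    ∎
          where
          split : actC b w ≈C (actC b (actC y Qr) CA.- actC b (single v))
          split = CΠ.▹-minus b (actC y Qr) (single v)

    extend : LiftsBelow (suc k) g⁺
    extend {v} v-chain (s≤s v≤k) with rank (top v) ℕ.<? k
    ... | yes v<k = record
      { π-lifts = MA.≈-trans (π.cong (g⁺-low v-chain v<k)) (LiftsAt.π-lifts (lifts v-chain v<k))
      ; equivar = λ b → NA.≈-trans (act*-g⁺-low v-chain (λ _ → ℕ.≤-<-trans (rank-mono ≤σ-·ʳ) v<k))
          (NA.≈-trans (LiftsAt.equivar (lifts v-chain v<k) b) (NA.▹-cong b (NA.≈-sym (g⁺-low v-chain v<k))))
      }
    ... | no v≮k  = record
      { π-lifts = MA.≈-trans (π.cong (g⁺-high v-chain v≮k)) (extended-lifts v-chain v≮k v≤k)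
      ; equivar = λ b → NA.≈-trans (equivar b (top v ≤σ? b)) (NA.▹-cong b (NA.≈-sym (g⁺-high v-chain v≮k)))
      }
      where
      equivar : ∀ b → Dec (top v ≤σ b) → act* b g⁺ v NA.≈ b NA.▹ extended v
      equivar b (yes y≤b) = extended-equivar-≥ v-chain v≮k v≤k b y≤b
      equivar b (no y≰b)  = extended-equivar-≱ v-chain v≮k v≤k b y≰b

  lift-below : ∀ k → ∃[ g ] (Supported g × LiftsBelow k g)
  -- No rank is below zero, so the zero cochain will do.
  lift-below zero    = (λ _ → NA.0#) , (λ _ → NA.≈-refl) , λ _ ()
  lift-below (suc k) with lift-below k
  ... | g , sg , lifts = g⁺ g sg lifts , g⁺-supported g sg lifts , extend g sg lifts

  lift : ∃[ g ] (IsKBHom R B (C q) (KBModule.raw N) g × (∀ h → π (g h) MA.≈ f h))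
  lift with lift-below (suc n)
  -- A rank counts elements of `B` and is at most `n`, so below `suc n` every tuple is covered.
  ... | ĝ , sĝ , lifts = ⟨ ĝ ,_⟩ , record
    { cong  = λ {h} {h′} → ⟨⟩-cong-≈C sĝ {h} {h′}
    ; hom-⊕ = ⟨⟩-++ ĝ
    ; hom-• = ⟨⟩-• ĝ
    ; hom-▹ = λ b h → low-equivar ĝ sĝ lifts (everything-low h) b
    } , λ h → low-lifts ĝ sĝ lifts (everything-low h)
    where
    everything-low : ∀ h → Low (suc n) h
    everything-low h = h , ListAll.universal (λ (_ , v) → s≤s (Subset.∣p∣≤n (downset (top v)))) h , CA.≈-refl {h}

theorem18 : ∀ {c ℓ m ℓm : Level} (R : CommutativeRing c ℓ) (B : LRB) →
    LRBNotions.Connected B →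
    (x : Fin (LRB.n B)) →
    ChainComplex.IsProjectiveResolution R B x m ℓm
theorem18 R B connected x = record
  { ε-hom      = ε-isHom
  ; ∂-hom      = ∂-isHom
  ; ε∂≈0       = ε∂≈0#
  ; ∂∂≈0       = ∂∂≈[]
  ; ε-surj     = ε-surjective
  ; exact₀     = exact-at-0 connected
  ; exact      = exact-at-suc connected
  ; projective = λ q M N π π-hom π-surj f f-hom → Lifting.lift R B x q M N π π-hom π-surj f f-hom
  }
  where open Exactness R B x
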